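{- For $i=1,2$, let $G_i$ be a nilpotent group, let $S_i$ be a symmetric finite generating set of $G_i$, and let $N_i$ be the torsion subgroup of $G_i$ (the set of all elements of finite order, a finite normal subgroup). Let $\varphi$ be a graph isomorphism from $\mathrm{Cay}(G_1;S_1)$ to $\mathrm{Cay}(G_2;S_2)$. Then $\varphi$ induces a well-defined map $\overline\varphi\colon G_1/N_1\to G_2/N_2$, $\overline\varphi(xN_1)=\varphi(x)N_2$, and $\overline\varphi$ is an affine bijection.
   Context: For a group $G$ and a symmetric subset $S$ ($S=S^{ -1}$), $\mathrm{Cay}(G;S)$ is the graph with vertex set $G$ in which $g$ is adjacent to $gs$ for all $g\in G$, $s\in S$. A map $\psi\colon H_1\to H_2$ between groups is an affine bijection if there exist a group isomorphism $\alpha\colon H_1\to H_2$ and $h\in H_2$ with $\psi(x)=h\,\alpha(x)$ for all $x\in H_1$. -}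

module Defs where

open import Level using (Level; _⊔_; Lift)
open import Algebra.Bundles using (Group)
open import Data.Nat using (ℕ; zero; suc)
open import Data.List using (List; foldr)
open import Data.List.Relation.Unary.Any using (Any)
open import Data.List.Relation.Unary.All using (All)
open import Data.Product using (Σ; _×_)

module _ {c ℓ : Level} (G : Group c ℓ) where
  open Group G

  pow : ℕ → Carrier → Carrier
  pow zero    x = ε
  pow (suc n) x = x ∙ pow n x

  IsTorsion : Carrier → Set ℓ
  IsTorsion x = Σ ℕ λ n → pow (suc n) x ≈ ε

  -- coset relation modulo the torsion set N:  x N = y N  iff  x⁻¹ y ∈ N
  _∼N_ : Carrier → Carrier → Set ℓ
  x ∼N y = IsTorsion (x ⁻¹ ∙ y)

  comm : Carrier → Carrier → Carrier
  comm x y = ((x ⁻¹ ∙ y ⁻¹) ∙ x) ∙ y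

  UpperCentral : ℕ → Carrier → Set (c ⊔ ℓ)
  UpperCentral zero    x = Lift c (x ≈ ε)
  UpperCentral (suc i) x = ∀ y → UpperCentral i (comm x y)

  IsNilpotent : Set (c ⊔ ℓ)
  IsNilpotent = Σ ℕ λ k → ∀ x → UpperCentral k x

  _∈S_ : Carrier → List Carrier → Set (c ⊔ ℓ)
  x ∈S S = Any (x ≈_) S

  IsSymmetric : List Carrier → Set (c ⊔ ℓ)
  IsSymmetric S = ∀ s → s ∈S S → (s ⁻¹) ∈S S

  Generates : List Carrier → Set (c ⊔ ℓ)
  Generates S = ∀ g → Σ (List Carrier) λ w → All (_∈S S) w × (foldr _∙_ ε w ≈ g)

  IsSymFinGenSet : List Carrier → Set (c ⊔ ℓ)
  IsSymFinGenSet S = IsSymmetric S × Generates S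

  CayAdj : List Carrier → Carrier → Carrier → Set (c ⊔ ℓ)
  CayAdj S g h = Σ Carrier λ s → (s ∈S S) × (h ≈ g ∙ s)

module _ {c₁ ℓ₁ c₂ ℓ₂ : Level} (G₁ : Group c₁ ℓ₁) (G₂ : Group c₂ ℓ₂) where
  private
    module G₁ = Group G₁
    module G₂ = Group G₂

  record IsCayleyIso (S₁ : List G₁.Carrier) (S₂ : List G₂.Carrier)
                     (φ : G₁.Carrier → G₂.Carrier) : Set (c₁ ⊔ ℓ₁ ⊔ c₂ ⊔ ℓ₂) where
    field
      φ-cong     : ∀ x y → x G₁.≈ y → φ x G₂.≈ φ y
      injective  : ∀ x y → φ x G₂.≈ φ y → x G₁.≈ y
      surjective : ∀ z → Σ G₁.Carrier λ x → φ x G₂.≈ z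
      adj-pres   : ∀ x y → CayAdj G₁ S₁ x y → CayAdj G₂ S₂ (φ x) (φ y)
      adj-refl   : ∀ x y → CayAdj G₂ S₂ (φ x) (φ y) → CayAdj G₁ S₁ x y

  InducedWellDefined : (G₁.Carrier → G₂.Carrier) → Set (c₁ ⊔ ℓ₁ ⊔ ℓ₂)
  InducedWellDefined φ = ∀ x y → _∼N_ G₁ x y → _∼N_ G₂ (φ x) (φ y)

  -- α (on representatives) induces a group isomorphism G₁/N₁ → G₂/N₂
  IsQuotientIso : (G₁.Carrier → G₂.Carrier) → Set (c₁ ⊔ ℓ₁ ⊔ c₂ ⊔ ℓ₂)
  IsQuotientIso α =
      (∀ x y → _∼N_ G₁ x y → _∼N_ G₂ (α x) (α y))
    × (∀ x y → _∼N_ G₂ (α (x G₁.∙ y)) (α x G₂.∙ α y))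
    × (∀ x y → _∼N_ G₂ (α x) (α y) → _∼N_ G₁ x y)
    × (∀ z → Σ G₁.Carrier λ x → _∼N_ G₂ (α x) z)

  InducedIsAffineBijection : (G₁.Carrier → G₂.Carrier) → Set (c₁ ⊔ ℓ₁ ⊔ c₂ ⊔ ℓ₂)
  InducedIsAffineBijection φ =
    Σ (G₁.Carrier → G₂.Carrier) λ α → IsQuotientIso α ×
      (Σ G₂.Carrier λ h → ∀ x → _∼N_ G₂ (φ x) (h G₂.∙ α x))

{-# OPTIONS --safe #-}
module Submission where

-- Suppose φ(1) = 1 and let c(x,y) = (φ(x)φ(y))⁻¹φ(xy).  Passing to quotients of G₂ along a central series,
-- one may assume that c is central; then c is a 2-cocycle.  Since s ↦ φ(x)⁻¹φ(xs) is a bijection from S₁ to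
-- S₂ for every x, the product of c(x,s) over s ∈ S₁ is 1, so y ↦ c(x,y) is harmonic on G₁, and for fixed y
-- the value c(x,y) ranges over a finite set.  If c(x₀,y₀) had infinite order, a linear functional would turn c
-- into an integer-valued cocycle D ≠ 0 with the same properties.  By induction on i,
-- D(x,yz) = D(x,y) + D(x,z) for z in the i-th centre of G₁: the function y ↦ D(x,yz) − D(x,y) = D(xy,z) − D(y,z)
-- is bounded, and its Laplacian is constant by the induction hypothesis, so it is constant by the maximum
-- principle.  Hence D is biadditive, and being bounded in x it vanishes.

open import Defs
open import Level using (Level; _⊔_; lift; lower)
open import Algebra.Bundles using (Group; AbelianGroup; CommutativeMonoid)
import Algebra.Properties.AbelianGroup as AbelianGroupProperties
import Algebra.Properties.CommutativeSemigroup as CommutativeSemigroupProperties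
import Algebra.Properties.Group as GroupProperties
open import Data.Bool using (Bool; true; false; not)
open import Data.Fin using (Fin; zero; suc)
open import Data.Fin.Permutation using (Permutation; _⟨$⟩ʳ_; permutation)
import Data.Fin.Properties as Fin
open import Data.Integer as ℤ using (ℤ; +_; -[1+_]; 0ℤ; 1ℤ; _+_; _*_; _-_; -_; _≤_; _<_; ∣_∣; _⊖_)
import Data.Integer.Properties as ℤ
open import Data.Integer.Tactic.RingSolver using (solve-∀)
open import Data.List using (List; []; _∷_; foldr)
open import Data.List.Relation.Unary.All using (All; []; _∷_)
open import Data.List.Relation.Unary.Any using (here; there)
open import Data.Nat as ℕ using (ℕ; zero; suc)
import Data.Nat.Properties as ℕ
open import Data.Product using (Σ; _×_; _,_; proj₁; proj₂)
open import Data.Sum using (_⊎_; inj₁; inj₂)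
open import Data.Vec as Vec using (Vec)
open import Data.Vec.Functional using (Vector) renaming (_∷_ to _◂_)
import Relation.Binary.Reasoning.Setoid as SetoidReasoning
import Relation.Binary.Reflection as Reflection
open import Relation.Binary.PropositionalEquality as ≡ using (_≡_; _≢_; _≗_)
open import Relation.Nullary using (Dec; yes; no; ¬_; contradiction)
open import Algebra.Properties.AbelianGroup ℤ.+-0-abelianGroup using () renaming (∙-cancelˡ to +-cancelˡ)
open import Algebra.Properties.Semiring.Sum ℤ.+-*-semiring
  using (sum; sum-cong-≗; ∑-distrib-+; *-distribˡ-sum; sum-permute)

-- Elements of S₂ need not commute, so the bijection S₁ → S₂ does not by itself make the product of
-- the c(x,s) trivial. But c(x,s) is a quotient of two elements of S₂ in one coset of the centre.
-- Dividing each element of S₂ by a representative of its coset gives finitely many central elements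
-- a_j with c(x,s) = a_j⁻¹a_k, and now the numerators and the denominators each run over all the
-- a_j. The same elements make the functional concrete. The cocycle identity, followed along a word
-- for y, writes c(x,y) as an integer combination of the a_j. So it is enough to have a functional
-- on exponent vectors that vanishes on all relations among the a_j, which elimination over the
-- integers provides. The length of the word also bounds the resulting values uniformly in x.
-- Integer values are what lets a bounded function attain its maximum. Injectivity of the induced
-- map comes from symmetry: the inverse of a graph isomorphism is again one.

private variable
  a b c c₁ c₂ ℓ ℓ₁ ℓ₂ r t : Level

-- Equality in the groups is not assumed decidable.  But every conclusion of the theorem has the form
-- IsTorsion z, and while proving it one may argue classically with T = IsTorsion z in the role of falsity.
module Classical {t} (T : Set t) where

  private variable
    X : Set a
    Y : Set b

  ◇ : Set a → Set (a ⊔ t)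
  ◇ X = (X → T) → T

  pure : X → ◇ X
  pure x k = k x

  infixl 1 _>>=_
  _>>=_ : ◇ X → (X → ◇ Y) → ◇ Y
  (m >>= f) k = m λ x → f x k

  map : (X → Y) → ◇ X → ◇ Y
  map f m k = m λ x → k (f x)

  excluded-middle : (X : Set a) → ◇ (X ⊎ (X → T))
  excluded-middle X k = k (inj₂ λ x → k (inj₁ x))

  by-cases : Dec X → (¬ X → T) → ◇ X
  by-cases (yes x) _ k = k x
  by-cases (no ¬x) f _ = f ¬x

  ◇-Fin : ∀ {n} {X : Fin n → Set a} → (∀ i → ◇ (X i)) → ◇ (∀ i → X i)
  ◇-Fin {n = zero}  f k = k λ ()
  ◇-Fin {n = suc n} f k = f zero λ x → ◇-Fin (λ i → f (suc i)) λ g → k λ where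
    zero    → x
    (suc i) → g i

-- Integer vectors

dot : ∀ {n} → Vector ℤ n → Vector ℤ n → ℤ
dot l k = sum λ i → l i * k i

comb : ∀ {n} → ℤ → Vector ℤ n → ℤ → Vector ℤ n → Vector ℤ n
comb a k b k′ i = a * k i - b * k′ i

sum-zero : ∀ {n} → sum {n} (λ _ → 0ℤ) ≡ 0ℤ
sum-zero {zero}  = ≡.refl
sum-zero {suc n} = ≡.trans (ℤ.+-identityˡ _) (sum-zero {n})

sum-neg : ∀ {n} (f : Vector ℤ n) → sum (λ i → - f i) ≡ - sum f
sum-neg {zero}  f = ≡.refl
sum-neg {suc n} f = ≡.trans (≡.cong (λ x → - f zero + x) (sum-neg λ i → f (suc i)))
  (≡.sym (ℤ.neg-distrib-+ (f zero) _))

dot-comb : ∀ {n} (l : Vector ℤ n) a k b k′ → dot l (comb a k b k′) ≡ a * dot l k - b * dot l k′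
dot-comb {zero}  l a k b k′ = lemma a b
  where
  lemma : ∀ a b → 0ℤ ≡ a * 0ℤ - b * 0ℤ
  lemma = solve-∀
dot-comb {suc n} l a k b k′ = ≡.trans
  (≡.cong (λ x → l zero * (a * k zero - b * k′ zero) + x) (dot-comb (λ i → l (suc i)) a _ b _))
  (lemma (l zero) a (k zero) b (k′ zero) _ _)
  where
  lemma : ∀ l a k b k′ x y → l * (a * k - b * k′) + (a * x - b * y) ≡ a * (l * k + x) - b * (l * k′ + y)
  lemma = solve-∀

dot-scale : ∀ {n} a (l k : Vector ℤ n) → dot (λ i → a * l i) k ≡ a * dot l k
dot-scale a l k = ≡.trans (sum-cong-≗ λ i → ℤ.*-assoc a (l i) (k i)) (≡.sym (*-distribˡ-sum a (λ i → l i * k i)))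

dot-zeroˡ : ∀ {n} (k : Vector ℤ n) → dot (λ _ → 0ℤ) k ≡ 0ℤ
dot-zeroˡ {n} k = ≡.trans (sum-cong-≗ {n} λ i → ℤ.*-zeroˡ (k i)) (sum-zero {n})

*-≢0 : ∀ {a b} → a ≢ 0ℤ → b ≢ 0ℤ → a * b ≢ 0ℤ
*-≢0 {a} {b} a≢0 b≢0 ab≡0 with ℤ.i*j≡0⇒i≡0∨j≡0 a ab≡0
... | inj₁ a≡0 = a≢0 a≡0
... | inj₂ b≡0 = b≢0 b≡0

record IsSubgroup {n} (R : Vector ℤ n → Set r) : Set r where
  field
    resp     : ∀ {k k′} → k ≗ k′ → R k → R k′
    has-zero : R (λ _ → 0ℤ)
    has-comb : ∀ a b {k k′} → R k → R k′ → R (comb a k b k′)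

module _ {t} (T : Set t) where
  open Classical T

  -- Gaussian elimination, one coordinate at a time.
  separation : ∀ {n} (R : Vector ℤ n → Set r) → IsSubgroup R → (k₀ : Vector ℤ n) →
    ◇ ((Σ ℤ λ a → a ≢ 0ℤ × R (λ i → a * k₀ i))
       ⊎ (Σ (Vector ℤ n) λ l → dot l k₀ ≢ 0ℤ × (∀ k → R k → ◇ (dot l k ≡ 0ℤ))))
  separation {n = zero} R sub k₀ = pure (inj₁ (1ℤ , (λ ()) , IsSubgroup.resp sub (λ ()) (IsSubgroup.has-zero sub)))
  separation {r = r} {n = suc n} R sub k₀ = excluded-middle (Σ (Vector ℤ (suc n)) λ k → R k × k zero ≢ 0ℤ) >>= λ where
      (inj₁ (k , Rk , k≢0)) → pivot k Rk k≢0
      (inj₂ none)           → no-pivot none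
    where
    open IsSubgroup sub
    tl : Vector ℤ (suc n) → Vector ℤ n
    tl k i = k (suc i)
    R′ : Vector ℤ n → Set r
    R′ k = R (0ℤ ◂ k)
    sub′ : IsSubgroup R′
    sub′ = record
      { resp     = λ eq → resp λ { zero → ≡.refl ; (suc i) → eq i }
      ; has-zero = resp (λ { zero → ≡.refl ; (suc i) → ≡.refl }) has-zero
      ; has-comb = λ a b Rk Rk′ → resp (λ { zero → zero-comb a b ; (suc i) → ≡.refl }) (has-comb a b Rk Rk′)
      }
      where
      zero-comb : ∀ a b → a * 0ℤ - b * 0ℤ ≡ 0ℤ
      zero-comb = solve-∀
    Goal = (Σ ℤ λ a → a ≢ 0ℤ × R (λ i → a * k₀ i))
       ⊎ (Σ (Vector ℤ (suc n)) λ l → dot l k₀ ≢ 0ℤ × (∀ k → R k → ◇ (dot l k ≡ 0ℤ)))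

    pivot : ∀ k → R k → k zero ≢ 0ℤ → ◇ Goal
    pivot k Rk k≢0 = separation R′ sub′ (reduce k₀) >>= λ where
        -- `reduce k₀` is `k zero` times `k₀` minus `k₀ zero` times `k`, so putting back
        -- `a * k₀ zero` copies of the pivot leaves `a * k zero` times `k₀`.
        (inj₁ (a , a≢0 , Rak)) → pure (inj₁ (a * k zero , *-≢0 a≢0 k≢0 ,
          resp (λ { zero    → eq₀ a (k₀ zero) (k zero)
                  ; (suc i) → eq₁ a (k₀ zero) (k zero) (k₀ (suc i)) (k (suc i)) })
               (has-comb 1ℤ (- (a * k₀ zero)) Rak Rk)))
        (inj₂ (l′ , l′k₀≢0 , kills)) → pure (inj₂
          -- The first entry is chosen so that the functional kills the pivot; its value on any `h`
          -- is then that of `l′` on `reduce h`.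
          ( (- dot l′ (tl k)) ◂ (λ i → k zero * l′ i)
          , (λ eq → l′k₀≢0 (≡.trans (≡.sym (dot-pivot l′ k₀)) eq))
          , λ h Rh → kills (reduce h)
              (resp (λ { zero → cancel (k zero) (h zero) ; (suc i) → ≡.refl }) (has-comb (k zero) (h zero) Rh Rk))
              >>= λ eq → pure (≡.trans (dot-pivot l′ h) eq)))
      where
      reduce : Vector ℤ (suc n) → Vector ℤ n
      reduce h = comb (k zero) (tl h) (h zero) (tl k)
      eq₀ : ∀ a x y → 1ℤ * 0ℤ - - (a * x) * y ≡ a * y * x
      eq₀ = solve-∀
      eq₁ : ∀ a x y z w → 1ℤ * (a * (y * z - x * w)) - - (a * x) * w ≡ a * y * z
      eq₁ = solve-∀
      cancel : ∀ x y → x * y - y * x ≡ 0ℤ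
      cancel = solve-∀
      dot-pivot : ∀ l′ h → dot ((- dot l′ (tl k)) ◂ (λ i → k zero * l′ i)) h ≡ dot l′ (reduce h)
      dot-pivot l′ h = ≡.trans
        (≡.cong (λ x → (- dot l′ (tl k)) * h zero + x) (dot-scale (k zero) l′ (tl h)))
        (≡.trans (lemma (dot l′ (tl k)) (h zero) (k zero) (dot l′ (tl h)))
                 (≡.sym (dot-comb l′ (k zero) (tl h) (h zero) (tl k))))
        where
        lemma : ∀ x y z w → - x * y + z * w ≡ z * w - y * x
        lemma = solve-∀

    no-pivot : ((Σ (Vector ℤ (suc n)) λ k → R k × k zero ≢ 0ℤ) → T) → ◇ Goal
    no-pivot none with k₀ zero ℤ.≟ 0ℤ
    -- Classically all of `R` has first coordinate zero here, so that coordinate itself separates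
    -- `k₀` from `R`.
    ... | no k₀≢0 = pure (inj₂ (1ℤ ◂ (λ _ → 0ℤ) , (λ eq → k₀≢0 (≡.trans (≡.sym (dot-1 k₀)) eq)) ,
          λ k Rk → by-cases (k zero ℤ.≟ 0ℤ) (λ k≢0 → none (k , Rk , k≢0)) >>= λ eq → pure (≡.trans (dot-1 k) eq)))
      where
      dot-1 : ∀ k → dot (1ℤ ◂ (λ _ → 0ℤ)) k ≡ k zero
      dot-1 k = ≡.trans (≡.cong₂ _+_ (ℤ.*-identityˡ (k zero)) (dot-zeroˡ (tl k))) (ℤ.+-identityʳ _)
    ... | yes k₀≡0 = separation R′ sub′ (tl k₀) >>= λ where
          (inj₁ (a , a≢0 , Rak)) → pure (inj₁ (a , a≢0 ,
            resp (λ { zero → ≡.sym (≡.trans (≡.cong (a *_) k₀≡0) (ℤ.*-zeroʳ a)) ; (suc i) → ≡.refl }) Rak))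
          (inj₂ (l′ , l′k₀≢0 , kills)) → pure (inj₂ (0ℤ ◂ l′ , (λ eq → l′k₀≢0 (≡.trans (≡.sym (dot-0 l′ k₀)) eq)) ,
            λ k Rk → by-cases (k zero ℤ.≟ 0ℤ) (λ k≢0 → none (k , Rk , k≢0)) >>= λ eq →
              kills (tl k) (resp (λ { zero → eq ; (suc i) → ≡.refl }) Rk) >>= λ eq′ →
              pure (≡.trans (dot-0 l′ k) eq′)))
      where
      dot-0 : ∀ l′ k → dot (0ℤ ◂ l′) k ≡ dot l′ (tl k)
      dot-0 l′ k = ≡.trans (≡.cong (_+ dot l′ (tl k)) (ℤ.*-zeroˡ (k zero))) (ℤ.+-identityˡ _)

-- A solver, by free reduction, for identities that hold in all groups

infixl 7 _⊕_
infix 8 _⊖¹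

data Expr (n : ℕ) : Set where
  var : Fin n → Expr n
  ε̂   : Expr n
  _⊕_ : Expr n → Expr n → Expr n
  _⊖¹ : Expr n → Expr n

commᴱ : ∀ {n} → Expr n → Expr n → Expr n
commᴱ x y = ((x ⊖¹ ⊕ y ⊖¹) ⊕ x) ⊕ y

module GroupSolver (G : Group c ℓ) where
  open Group G
  open GroupProperties G
  open SetoidReasoning setoid

  Word : ℕ → Set
  Word n = List (Bool × Fin n)

  ⟦_⟧ : ∀ {n} → Expr n → Vec Carrier n → Carrier
  ⟦ var i ⟧ ρ = Vec.lookup ρ i
  ⟦ ε̂ ⟧     ρ = ε
  ⟦ a ⊕ b ⟧ ρ = ⟦ a ⟧ ρ ∙ ⟦ b ⟧ ρ
  ⟦ a ⊖¹ ⟧  ρ = ⟦ a ⟧ ρ ⁻¹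

  signed : Bool → Carrier → Carrier
  signed true  x = x
  signed false x = x ⁻¹

  ⟦_⟧ʷ : ∀ {n} → Word n → Vec Carrier n → Carrier
  ⟦ [] ⟧ʷ          ρ = ε
  ⟦ (s , i) ∷ w ⟧ʷ ρ = signed s (Vec.lookup ρ i) ∙ ⟦ w ⟧ʷ ρ

  cons : ∀ {n} → Bool → Fin n → Word n → Word n
  cons s i [] = (s , i) ∷ []
  cons true i ((false , j) ∷ w) with i Fin.≟ j
  ... | yes _ = w
  ... | no _  = (true , i) ∷ (false , j) ∷ w
  cons false i ((true , j) ∷ w) with i Fin.≟ j
  ... | yes _ = w
  ... | no _  = (false , i) ∷ (true , j) ∷ w
  cons true  i ((true  , j) ∷ w) = (true , i) ∷ (true , j) ∷ w
  cons false i ((false , j) ∷ w) = (false , i) ∷ (false , j) ∷ w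

  -- The flag carries inversions down to the variables, and `w` is the already reduced rest of the
  -- word, so each new letter is compared with its right neighbour only.
  norm : ∀ {n} → Bool → Expr n → Word n → Word n
  norm s     (var i) w = cons s i w
  norm s     ε̂       w = w
  norm true  (a ⊕ b) w = norm true a (norm true b w)
  norm false (a ⊕ b) w = norm false b (norm false a w)
  norm s     (a ⊖¹)  w = norm (not s) a w

  cons-correct : ∀ {n} s (i : Fin n) w ρ → ⟦ cons s i w ⟧ʷ ρ ≈ signed s (Vec.lookup ρ i) ∙ ⟦ w ⟧ʷ ρ
  cons-correct s i [] ρ = refl
  cons-correct true i ((false , j) ∷ w) ρ with i Fin.≟ j
  ... | yes ≡.refl = sym (\\-leftDividesˡ _ _)
  ... | no _       = refl
  cons-correct false i ((true , j) ∷ w) ρ with i Fin.≟ j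
  ... | yes ≡.refl = sym (\\-leftDividesʳ _ _)
  ... | no _       = refl
  cons-correct true  i ((true  , j) ∷ w) ρ = refl
  cons-correct false i ((false , j) ∷ w) ρ = refl

  norm-correct : ∀ {n} s (a : Expr n) w ρ → ⟦ norm s a w ⟧ʷ ρ ≈ signed s (⟦ a ⟧ ρ) ∙ ⟦ w ⟧ʷ ρ
  norm-correct s     (var i) w ρ = cons-correct s i w ρ
  norm-correct true  ε̂       w ρ = sym (identityˡ _)
  norm-correct false ε̂       w ρ = sym (trans (∙-congʳ ε⁻¹≈ε) (identityˡ _))
  norm-correct true  (a ⊕ b) w ρ = begin
    ⟦ norm true a (norm true b w) ⟧ʷ ρ ≈⟨ norm-correct true a _ ρ ⟩
    ⟦ a ⟧ ρ ∙ ⟦ norm true b w ⟧ʷ ρ     ≈⟨ ∙-congˡ (norm-correct true b w ρ) ⟩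
    ⟦ a ⟧ ρ ∙ (⟦ b ⟧ ρ ∙ ⟦ w ⟧ʷ ρ)     ≈⟨ assoc _ _ _ ⟨
    ⟦ a ⟧ ρ ∙ ⟦ b ⟧ ρ ∙ ⟦ w ⟧ʷ ρ       ∎
  norm-correct false (a ⊕ b) w ρ = begin
    ⟦ norm false b (norm false a w) ⟧ʷ ρ     ≈⟨ norm-correct false b _ ρ ⟩
    ⟦ b ⟧ ρ ⁻¹ ∙ ⟦ norm false a w ⟧ʷ ρ       ≈⟨ ∙-congˡ (norm-correct false a w ρ) ⟩
    ⟦ b ⟧ ρ ⁻¹ ∙ (⟦ a ⟧ ρ ⁻¹ ∙ ⟦ w ⟧ʷ ρ)     ≈⟨ assoc _ _ _ ⟨
    ⟦ b ⟧ ρ ⁻¹ ∙ ⟦ a ⟧ ρ ⁻¹ ∙ ⟦ w ⟧ʷ ρ       ≈⟨ ∙-congʳ (⁻¹-anti-homo-∙ _ _) ⟨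
    (⟦ a ⟧ ρ ∙ ⟦ b ⟧ ρ) ⁻¹ ∙ ⟦ w ⟧ʷ ρ        ∎
  norm-correct true  (a ⊖¹)  w ρ = norm-correct false a w ρ
  norm-correct false (a ⊖¹)  w ρ = trans (norm-correct true a w ρ) (∙-congʳ (sym (⁻¹-involutive _)))

  ⟦_⇓⟧ : ∀ {n} → Expr n → Vec Carrier n → Carrier
  ⟦ a ⇓⟧ = ⟦ norm true a [] ⟧ʷ

  correct : ∀ {n} (a : Expr n) ρ → ⟦ a ⇓⟧ ρ ≈ ⟦ a ⟧ ρ
  correct a ρ = trans (norm-correct true a [] ρ) (identityʳ _)

  open Reflection setoid var ⟦_⟧ ⟦_⇓⟧ correct public using (solve; _⊜_)

-- Normal subgroups and quotients

record IsNormal (G : Group c ℓ) (M : Group.Carrier G → Set r) : Set (c ⊔ ℓ ⊔ r) where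
  open Group G
  field
    resp : ∀ {x y} → x ≈ y → M x → M y
    has-ε : M ε
    has-∙ : ∀ {x y} → M x → M y → M (x ∙ y)
    has-⁻¹ : ∀ {x} → M x → M (x ⁻¹)
    has-conj : ∀ {x} y → M x → M (y ⁻¹ ∙ x ∙ y)

module _ (G : Group c ℓ) {M : Group.Carrier G → Set r} (N : IsNormal G M) where
  open Group G
  open IsNormal N
  open GroupSolver G

  ≈⇒M : ∀ {x y} → x ≈ y → M (x ⁻¹ ∙ y)
  ≈⇒M x≈y = resp (sym (trans (∙-congˡ (sym x≈y)) (inverseˡ _))) has-ε

  -- Only the equality is coarsened; carrier and operations stay. So one map `φ` serves as a map
  -- into every quotient, and equality modulo the torsion subgroup is `_∼N_` by definition.
  Quotient : Group c r
  Quotient = record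
    { Carrier = Carrier
    ; _≈_ = λ x y → M (x ⁻¹ ∙ y)
    ; _∙_ = _∙_
    ; ε = ε
    ; _⁻¹ = _⁻¹
    ; isGroup = record
      { isMonoid = record
        { isSemigroup = record
          { isMagma = record
            { isEquivalence = record
              { refl = ≈⇒M refl
              ; sym = λ {x} {y} m → resp (solve 2 (λ x y → (x ⊖¹ ⊕ y) ⊖¹ ⊜ y ⊖¹ ⊕ x) refl x y) (has-⁻¹ m)
              ; trans = λ {x} {y} {z} m m′ → resp
                  (solve 3 (λ x y z → (x ⊖¹ ⊕ y) ⊕ (y ⊖¹ ⊕ z) ⊜ x ⊖¹ ⊕ z) refl x y z) (has-∙ m m′)
              }
            ; ∙-cong = λ {x} {x′} {y} {y′} m m′ → resp
                (solve 4 (λ x x′ y y′ → (y ⊖¹ ⊕ (x ⊖¹ ⊕ x′) ⊕ y) ⊕ (y ⊖¹ ⊕ y′) ⊜ (x ⊕ y) ⊖¹ ⊕ (x′ ⊕ y′)) refl x x′ y y′)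
                (has-∙ (has-conj y m) m′)
            }
          ; assoc = λ x y z → ≈⇒M (assoc x y z)
          }
        ; identity = (λ x → ≈⇒M (identityˡ x)) , λ x → ≈⇒M (identityʳ x)
        }
      ; inverse = (λ x → ≈⇒M (inverseˡ x)) , λ x → ≈⇒M (inverseʳ x)
      ; ⁻¹-cong = λ {x} {y} m → resp
          (solve 2 (λ x y → ((x ⊖¹) ⊖¹ ⊕ (x ⊖¹ ⊕ y) ⊖¹) ⊕ x ⊖¹ ⊜ (x ⊖¹) ⊖¹ ⊕ y ⊖¹) refl x y)
          (has-conj (x ⁻¹) (has-⁻¹ m))
      }
    }

  ≈ε⇒M : ∀ {x} → Group._≈_ Quotient x ε → M x
  ≈ε⇒M {x} m = resp (solve 1 (λ x → (x ⊖¹ ⊕ ε̂) ⊖¹ ⊜ x) refl x) (has-⁻¹ m)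

  M⇒≈ε : ∀ {x} → M x → Group._≈_ Quotient x ε
  M⇒≈ε {x} m = resp (solve 1 (λ x → x ⊖¹ ⊜ x ⊖¹ ⊕ ε̂) refl x) (has-⁻¹ m)

  pow-Quotient : ∀ n x → pow Quotient n x ≡ pow G n x
  pow-Quotient zero    x = ≡.refl
  pow-Quotient (suc n) x = ≡.cong (x ∙_) (pow-Quotient n x)

-- Powers and torsion elements

module Powers (G : Group c ℓ) where
  open Group G
  open GroupSolver G
  open SetoidReasoning setoid

  pow-cong : ∀ n {x y} → x ≈ y → pow G n x ≈ pow G n y
  pow-cong zero    x≈y = refl
  pow-cong (suc n) x≈y = ∙-cong x≈y (pow-cong n x≈y)

  pow-ε : ∀ n → pow G n ε ≈ ε
  pow-ε zero    = refl
  pow-ε (suc n) = trans (identityˡ _) (pow-ε n)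

  pow-+ : ∀ m n x → pow G (m ℕ.+ n) x ≈ pow G m x ∙ pow G n x
  pow-+ zero    n x = sym (identityˡ _)
  pow-+ (suc m) n x = trans (∙-congˡ (pow-+ m n x)) (sym (assoc _ _ _))

  pow-* : ∀ m n x → pow G (m ℕ.* n) x ≈ pow G m (pow G n x)
  pow-* zero    n x = refl
  pow-* (suc m) n x = trans (pow-+ n (m ℕ.* n) x) (∙-congˡ (pow-* m n x))

  pow-commute : ∀ n {x y} → x ∙ y ≈ y ∙ x → pow G n x ∙ y ≈ y ∙ pow G n x
  pow-commute zero    {x} {y} eq = trans (identityˡ y) (sym (identityʳ y))
  pow-commute (suc n) {x} {y} eq = begin
    x ∙ pow G n x ∙ y   ≈⟨ assoc _ _ _ ⟩
    x ∙ (pow G n x ∙ y) ≈⟨ ∙-congˡ (pow-commute n eq) ⟩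
    x ∙ (y ∙ pow G n x) ≈⟨ assoc _ _ _ ⟨
    x ∙ y ∙ pow G n x   ≈⟨ ∙-congʳ eq ⟩
    y ∙ x ∙ pow G n x   ≈⟨ assoc _ _ _ ⟩
    y ∙ (x ∙ pow G n x) ∎

  pow-∙ : ∀ n {x y} → x ∙ y ≈ y ∙ x → pow G n (x ∙ y) ≈ pow G n x ∙ pow G n y
  pow-∙ zero    eq = sym (identityˡ _)
  pow-∙ (suc n) {x} {y} eq = begin
    x ∙ y ∙ pow G n (x ∙ y)         ≈⟨ ∙-congˡ (pow-∙ n eq) ⟩
    x ∙ y ∙ (pow G n x ∙ pow G n y) ≈⟨ solve 4 (λ a b p q → a ⊕ b ⊕ (p ⊕ q) ⊜ a ⊕ (b ⊕ p) ⊕ q) refl _ _ _ _ ⟩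
    x ∙ (y ∙ pow G n x) ∙ pow G n y ≈⟨ ∙-congʳ (∙-congˡ (pow-commute n eq)) ⟨
    x ∙ (pow G n x ∙ y) ∙ pow G n y ≈⟨ solve 4 (λ a b p q → a ⊕ (p ⊕ b) ⊕ q ⊜ a ⊕ p ⊕ (b ⊕ q)) refl _ _ _ _ ⟩
    x ∙ pow G n x ∙ (y ∙ pow G n y) ∎

  pow-conj : ∀ n x y → pow G n (y ⁻¹ ∙ x ∙ y) ≈ y ⁻¹ ∙ pow G n x ∙ y
  pow-conj zero    x y = solve 1 (λ y → ε̂ ⊜ y ⊖¹ ⊕ ε̂ ⊕ y) refl y
  pow-conj (suc n) x y = trans (∙-congˡ (pow-conj n x y))
    (solve 3 (λ x y p → y ⊖¹ ⊕ x ⊕ y ⊕ (y ⊖¹ ⊕ p ⊕ y) ⊜ y ⊖¹ ⊕ (x ⊕ p) ⊕ y) refl x y (pow G n x))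

  pow-⁻¹ : ∀ n x → pow G n (x ⁻¹) ≈ pow G n x ⁻¹
  pow-⁻¹ zero    x = solve 0 (ε̂ ⊜ ε̂ ⊖¹) refl
  pow-⁻¹ (suc n) x = begin
    x ⁻¹ ∙ pow G n (x ⁻¹) ≈⟨ pow-commute n refl ⟨
    pow G n (x ⁻¹) ∙ x ⁻¹ ≈⟨ ∙-congʳ (pow-⁻¹ n x) ⟩
    pow G n x ⁻¹ ∙ x ⁻¹   ≈⟨ solve 2 (λ x p → p ⊖¹ ⊕ x ⊖¹ ⊜ (x ⊕ p) ⊖¹) refl x (pow G n x) ⟩
    (x ∙ pow G n x) ⁻¹    ∎

  torsion-cong : ∀ {x y} → x ≈ y → IsTorsion G x → IsTorsion G y
  torsion-cong x≈y (n , eq) = n , trans (pow-cong (suc n) (sym x≈y)) eq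

  torsion-ε : IsTorsion G ε
  torsion-ε = 0 , pow-ε 1

  torsion-⁻¹ : ∀ {x} → IsTorsion G x → IsTorsion G (x ⁻¹)
  torsion-⁻¹ (n , eq) = n , trans (pow-⁻¹ (suc n) _) (trans (⁻¹-cong eq) (solve 0 (ε̂ ⊖¹ ⊜ ε̂) refl))

  torsion-conj : ∀ {x} y → IsTorsion G x → IsTorsion G (y ⁻¹ ∙ x ∙ y)
  torsion-conj y (n , eq) = n , trans (pow-conj (suc n) _ y)
    (trans (∙-congʳ (∙-congˡ eq)) (solve 1 (λ y → y ⊖¹ ⊕ ε̂ ⊕ y ⊜ ε̂) refl y))

  torsion-root : ∀ n {x} → IsTorsion G (pow G (suc n) x) → IsTorsion G x
  -- `IsTorsion` stores the exponent less one, and this number is (m+1)(n+1) - 1.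
  torsion-root n {x} (m , eq) = n ℕ.+ m ℕ.* suc n , trans (pow-* (suc m) (suc n) x) eq

  common-exponent : ∀ {x y} → IsTorsion G x → IsTorsion G y →
    Σ ℕ λ n → pow G (suc n) x ≈ ε × pow G (suc n) y ≈ ε
  common-exponent {x} {y} (m , eq) (n , eq′) = n ℕ.+ m ℕ.* suc n
    , trans (reflexive (≡.cong (λ k → pow G k x) (ℕ.*-comm (suc m) (suc n))))
        (trans (pow-* (suc n) (suc m) x) (trans (pow-cong (suc n) eq) (pow-ε (suc n))))
    , trans (pow-* (suc m) (suc n) y) (trans (pow-cong (suc m) eq′) (pow-ε (suc m)))

-- The upper central series and torsion in nilpotent groups

module Nilpotent (G : Group c ℓ) where
  open Group G
  open GroupSolver G
  open SetoidReasoning setoid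
  open Powers G

  -- Identities such as [ab,y] = b⁻¹[a,y]b · [b,y] express membership in the next centre through the
  -- normal subgroup below it.
  UpperCentral-normal : ∀ i → IsNormal G (UpperCentral G i)
  UpperCentral-normal zero = record
    { resp = λ x≈y (lift x≈ε) → lift (trans (sym x≈y) x≈ε)
    ; has-ε = lift refl
    ; has-∙ = λ (lift x≈ε) (lift y≈ε) → lift (trans (∙-cong x≈ε y≈ε) (identityˡ ε))
    ; has-⁻¹ = λ (lift x≈ε) → lift (trans (⁻¹-cong x≈ε) (solve 0 (ε̂ ⊖¹ ⊜ ε̂) refl))
    ; has-conj = λ y (lift x≈ε) → lift (trans (∙-congʳ (∙-congˡ x≈ε)) (solve 1 (λ y → y ⊖¹ ⊕ ε̂ ⊕ y ⊜ ε̂) refl y))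
    }
  UpperCentral-normal (suc i) = record
    { resp = λ x≈x′ z y → resp (∙-congʳ (∙-cong (∙-congʳ (⁻¹-cong x≈x′)) x≈x′)) (z y)
    ; has-ε = λ y → resp (solve 1 (λ y → ε̂ ⊜ commᴱ ε̂ y) refl y) has-ε
    ; has-∙ = λ {a} {b} za zb y → resp
        (solve 3 (λ a b y → (b ⊖¹ ⊕ commᴱ a y ⊕ b) ⊕ commᴱ b y ⊜ commᴱ (a ⊕ b) y) refl a b y)
        (has-∙ (has-conj b (za y)) (zb y))
    ; has-⁻¹ = λ {a} za y → resp
        (solve 2 (λ a y → (a ⊖¹) ⊖¹ ⊕ commᴱ a y ⊖¹ ⊕ a ⊖¹ ⊜ commᴱ (a ⊖¹) y) refl a y)
        (has-conj (a ⁻¹) (has-⁻¹ (za y)))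
    ; has-conj = λ {a} g za y → resp
        (solve 3 (λ a g y → g ⊖¹ ⊕ commᴱ a (g ⊕ y ⊕ g ⊖¹) ⊕ g ⊜ commᴱ (g ⊖¹ ⊕ a ⊕ g) y) refl a g y)
        (has-conj g (za (g ∙ y ∙ g ⁻¹)))
    }
    where open IsNormal (UpperCentral-normal i)

  -- With u = a⁻¹b, the commutator of a and u is torsion by induction, so a and u commute modulo torsion
  -- in the i-th centre, where therefore bⁿ = aⁿuⁿ.
  equal-powers : ∀ i n a b → pow G (suc n) a ≈ pow G (suc n) b →
    UpperCentral G i (a ⁻¹ ∙ b) → IsTorsion G (a ⁻¹ ∙ b)
  equal-powers zero    n a b eq (lift a⁻¹b≈ε) = torsion-cong (sym a⁻¹b≈ε) torsion-ε
  equal-powers (suc i) n a b eq zu = torsion-root n (proj₁ (resp p⁻¹p′ (Q.trans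
      (Q.reflexive (≡.sym (pow-Quotient G M-normal N (a ∙ u))))
      (Q.trans (Powers.pow-∙ Q N au≈ua)
        (Q.reflexive (≡.cong₂ _∙_ (pow-Quotient G M-normal N a) (pow-Quotient G M-normal N u)))))))
    where
    module Z = IsNormal (UpperCentral-normal i)
    N = suc n
    u = a ⁻¹ ∙ b
    aᴺ = pow G N a
    M : Carrier → Set _
    M x = IsTorsion G x × UpperCentral G i x
    M-∙ : ∀ {x y} → M x → M y → M (x ∙ y)
    -- With a common exponent `x ⁻¹` and `y` have the same, trivial power, so the induction
    -- hypothesis makes their quotient `x ∙ y` torsion.
    M-∙ {x} {y} (tx , zx) (ty , zy) with common-exponent (torsion-⁻¹ tx) ty
    ... | m , eqx , eqy =
      torsion-cong x⁻¹⁻¹y (equal-powers i m (x ⁻¹) y (trans eqx (sym eqy)) (Z.resp (sym x⁻¹⁻¹y) zxy)) , zxy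
      where
      zxy = Z.has-∙ zx zy
      x⁻¹⁻¹y = solve 2 (λ x y → (x ⊖¹) ⊖¹ ⊕ y ⊜ x ⊕ y) refl x y
    M-normal : IsNormal G M
    M-normal = record
      { resp = λ x≈y (t , z) → torsion-cong x≈y t , Z.resp x≈y z
      ; has-ε = torsion-ε , Z.has-ε
      ; has-∙ = M-∙
      ; has-⁻¹ = λ (t , z) → torsion-⁻¹ t , Z.has-⁻¹ z
      ; has-conj = λ y (t , z) → torsion-conj y t , Z.has-conj y z
      }
    open IsNormal M-normal
    Q = Quotient G M-normal
    module Q = Group Q

    pa≈ap : aᴺ ∙ a ≈ a ∙ aᴺ
    pa≈ap = pow-commute N refl
    pb≈bp : aᴺ ∙ b ≈ b ∙ aᴺ
    pb≈bp = trans (∙-congʳ eq) (trans (pow-commute N refl) (∙-congˡ (sym eq)))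
    -- `aᴺ` is also a power of `b`, so it commutes with `a`, with `b` and hence with `u`. Thus `a`
    -- and its conjugate by `u` have equal powers, which is what the induction hypothesis asks of
    -- them.
    pow-a^u : aᴺ ≈ pow G N (u ⁻¹ ∙ a ∙ u)
    pow-a^u = sym (begin
      pow G N (u ⁻¹ ∙ a ∙ u)      ≈⟨ pow-conj N a u ⟩
      u ⁻¹ ∙ aᴺ ∙ u
        ≈⟨ solve 3 (λ a b p → (a ⊖¹ ⊕ b) ⊖¹ ⊕ p ⊕ (a ⊖¹ ⊕ b) ⊜ b ⊖¹ ⊕ (a ⊕ p) ⊕ a ⊖¹ ⊕ b) refl a b aᴺ ⟩
      b ⁻¹ ∙ (a ∙ aᴺ) ∙ a ⁻¹ ∙ b   ≈⟨ ∙-congʳ (∙-congʳ (∙-congˡ pa≈ap)) ⟨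
      b ⁻¹ ∙ (aᴺ ∙ a) ∙ a ⁻¹ ∙ b   ≈⟨ solve 3 (λ a b p → b ⊖¹ ⊕ (p ⊕ a) ⊕ a ⊖¹ ⊕ b ⊜ b ⊖¹ ⊕ (p ⊕ b)) refl a b aᴺ ⟩
      b ⁻¹ ∙ (aᴺ ∙ b)              ≈⟨ ∙-congˡ pb≈bp ⟩
      b ⁻¹ ∙ (b ∙ aᴺ)              ≈⟨ solve 2 (λ b p → b ⊖¹ ⊕ (b ⊕ p) ⊜ p) refl b aᴺ ⟩
      aᴺ                          ∎)
    zau : UpperCentral G i (a ⁻¹ ∙ (u ⁻¹ ∙ a ∙ u))
    zau = Z.resp (solve 2 (λ a u → commᴱ u a ⊖¹ ⊜ a ⊖¹ ⊕ (u ⊖¹ ⊕ a ⊕ u)) refl a u) (Z.has-⁻¹ (zu a))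
    au≈ua : a ∙ u Q.≈ u ∙ a
    au≈ua = resp (solve 2 (λ a u → (a ⊖¹ ⊕ (u ⊖¹ ⊕ a ⊕ u)) ⊖¹ ⊜ (a ⊕ u) ⊖¹ ⊕ (u ⊕ a)) refl a u)
      (has-⁻¹ (equal-powers i n a (u ⁻¹ ∙ a ∙ u) pow-a^u zau , zau))
    p⁻¹p′ : pow G N (a ∙ u) ⁻¹ ∙ (aᴺ ∙ pow G N u) ≈ pow G N u
    p⁻¹p′ = begin
      pow G N (a ∙ u) ⁻¹ ∙ (aᴺ ∙ pow G N u)
        ≈⟨ ∙-congʳ (⁻¹-cong (trans (pow-cong N (solve 2 (λ a b → a ⊕ (a ⊖¹ ⊕ b) ⊜ b) refl a b)) (sym eq))) ⟩
      aᴺ ⁻¹ ∙ (aᴺ ∙ pow G N u)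
        ≈⟨ solve 2 (λ p q → p ⊖¹ ⊕ (p ⊕ q) ⊜ q) refl aᴺ (pow G N u) ⟩
      pow G N u ∎

  torsion-normal : IsNilpotent G → IsNormal G (IsTorsion G)
  torsion-normal (k , nil) = record
    { resp = torsion-cong
    ; has-ε = torsion-ε
    ; has-∙ = λ {x} {y} tx ty → let (n , eqx , eqy) = common-exponent (torsion-⁻¹ tx) ty in
        torsion-cong (solve 2 (λ x y → (x ⊖¹) ⊖¹ ⊕ y ⊜ x ⊕ y) refl x y)
          (equal-powers k n (x ⁻¹) y (trans eqx (sym eqy)) (nil _))
    ; has-⁻¹ = torsion-⁻¹
    ; has-conj = torsion-conj
    }

  central-commutes : ∀ {z} → UpperCentral G 1 z → ∀ y → z ∙ y ≈ y ∙ z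
  central-commutes {z} zz y = begin
    z ∙ y                ≈⟨ solve 2 (λ z y → z ⊕ y ⊜ y ⊕ z ⊕ commᴱ z y) refl z y ⟩
    y ∙ z ∙ comm G z y   ≈⟨ ∙-congˡ (lower (zz y)) ⟩
    y ∙ z ∙ ε            ≈⟨ identityʳ _ ⟩
    y ∙ z                ∎

  -- Conjugating `z` by `y` fixes the central power, so `z` and its conjugate have equal powers and
  -- `equal-powers` applies. This is how torsion modulo the centre becomes centrality modulo
  -- torsion.
  root-of-central : IsNilpotent G → ∀ n z → UpperCentral G 1 (pow G (suc n) z) → ∀ y → IsTorsion G (comm G z y)
  root-of-central (k , nil) n z zz y = torsion-cong
    (solve 2 (λ z y → z ⊖¹ ⊕ (y ⊖¹ ⊕ z ⊕ y) ⊜ commᴱ z y) refl z y)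
    (equal-powers k n z (y ⁻¹ ∙ z ∙ y) (sym (begin
      pow G (suc n) (y ⁻¹ ∙ z ∙ y)     ≈⟨ pow-conj (suc n) z y ⟩
      y ⁻¹ ∙ pow G (suc n) z ∙ y       ≈⟨ assoc _ _ _ ⟩
      y ⁻¹ ∙ (pow G (suc n) z ∙ y)     ≈⟨ ∙-congˡ (central-commutes zz y) ⟩
      y ⁻¹ ∙ (y ∙ pow G (suc n) z)     ≈⟨ solve 2 (λ y p → y ⊖¹ ⊕ (y ⊕ p) ⊜ p) refl y _ ⟩
      pow G (suc n) z                  ∎)) (nil _))

  UpperCentral-mod-centre : ∀ i {x} → UpperCentral G (suc i) x →
    UpperCentral (Quotient G (UpperCentral-normal 1)) i x
  UpperCentral-mod-centre zero    zx   = lift (M⇒≈ε G (UpperCentral-normal 1) zx)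
  UpperCentral-mod-centre (suc i) zx y = UpperCentral-mod-centre i (zx y)

-- The maximum principle on a Cayley graph

i≤∣i∣ : ∀ i → i ≤ + ∣ i ∣
i≤∣i∣ (+ n)    = ℤ.≤-refl
i≤∣i∣ -[1+ n ] = ℤ.-≤+

sum-≤0 : ∀ {n} (f : Vector ℤ n) → (∀ i → f i ≤ 0ℤ) → sum f ≤ 0ℤ
sum-≤0 {zero}  f f≤0 = ℤ.≤-refl
sum-≤0 {suc n} f f≤0 = ℤ.+-mono-≤ (f≤0 zero) (sum-≤0 (λ i → f (suc i)) λ i → f≤0 (suc i))

sum-≥0⇒≡0 : ∀ {n} (f : Vector ℤ n) → (∀ i → f i ≤ 0ℤ) → 0ℤ ≤ sum f → ∀ i → f i ≡ 0ℤ
sum-≥0⇒≡0 {suc n} f f≤0 0≤s zero = ℤ.≤-antisym (f≤0 zero)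
  (ℤ.≤-trans 0≤s (ℤ.≤-trans (ℤ.+-monoʳ-≤ (f zero) (sum-≤0 (λ i → f (suc i)) λ i → f≤0 (suc i)))
    (ℤ.≤-reflexive (ℤ.+-identityʳ (f zero)))))
sum-≥0⇒≡0 {suc n} f f≤0 0≤s (suc i) = sum-≥0⇒≡0 (λ i → f (suc i)) (λ i → f≤0 (suc i))
  (ℤ.≤-trans 0≤s (ℤ.≤-trans (ℤ.+-monoˡ-≤ _ (f≤0 zero)) (ℤ.≤-reflexive (ℤ.+-identityˡ _)))) i

module Words (G : Group c ℓ) {m} (u : Fin m → Group.Carrier G) where
  open Group G hiding (_-_)

  evaluate : List (Fin m) → Carrier
  evaluate = foldr (λ i g → u i ∙ g) ε

  Generating : Set (c ⊔ ℓ)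
  Generating = ∀ g → Σ (List (Fin m)) λ w → evaluate w ≈ g

module MaximumPrinciple {t} (T : Set t) (G : Group c ℓ) {m} (u : Fin m → Group.Carrier G)
  (gen : Words.Generating G u) where
  open Group G hiding (_-_)
  open Words G u
  open GroupSolver G
  open Classical T

  module _ (f : Carrier → ℤ) (B : ℤ) (bound : ∀ y → f y ≤ B)
    (f-cong : ∀ {x y} → x ≈ y → ◇ (f x ≡ f y))
    (subharmonic : ∀ y → ◇ (0ℤ ≤ sum λ i → f (y ∙ u i) - f y)) where

    IsMax : Carrier → Set _
    IsMax y* = ∀ y → ◇ (f y ≤ f y*)

    -- The gap between `f y₀` and the bound `B` serves as fuel: values are integers, so every
    -- strictly larger value closes the gap by at least one.
    climb : ∀ n y₀ → B ≤ f y₀ + + n → ◇ (Σ Carrier IsMax)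
    climb zero    y₀ B≤ = pure (y₀ , λ y → pure
      (ℤ.≤-trans (bound y) (ℤ.≤-trans B≤ (ℤ.≤-reflexive (ℤ.+-identityʳ (f y₀))))))
    climb (suc n) y₀ B≤ = excluded-middle (Σ Carrier λ y → f y₀ < f y) >>= λ where
        (inj₁ (y , f<)) → climb n y (ℤ.≤-trans B≤ (ℤ.≤-trans
          (ℤ.≤-reflexive (shift (f y₀) (+ n))) (ℤ.+-monoˡ-≤ (+ n) (ℤ.i<j⇒suc[i]≤j f<))))
        (inj₂ none) → pure (y₀ , λ y → by-cases (f y ℤ.≤? f y₀) λ f≰ → none (y , ℤ.≰⇒> f≰))
      where
      shift : ∀ a b → a + (1ℤ + b) ≡ (1ℤ + a) + b
      shift = solve-∀

    maximum : ◇ (Σ Carrier IsMax)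
    maximum = climb ∣ B - f ε ∣ ε (ℤ.≤-trans (ℤ.≤-reflexive (cancel B (f ε))) (ℤ.+-monoʳ-≤ (f ε) (i≤∣i∣ (B - f ε))))
      where
      cancel : ∀ a b → a ≡ b + (a - b)
      cancel = solve-∀

    -- At a maximum all increments are nonpositive while their sum is nonnegative, so each of them
    -- is zero and every neighbour is again a maximum.
    spread : ∀ {y*} → IsMax y* → ∀ w y → f y ≡ f y* → ◇ (f (y ∙ evaluate w) ≡ f y*)
    spread max []      y eq = f-cong (identityʳ y) >>= λ eq′ → pure (≡.trans eq′ eq)
    spread max (i ∷ w) y eq =
      ◇-Fin (λ j → max (y ∙ u j)) >>= λ ≤max →
      subharmonic y >>= λ 0≤s →
      spread max w (y ∙ u i) (≡.trans
        (ℤ.i-j≡0⇒i≡j (f (y ∙ u i)) (f y) (sum-≥0⇒≡0 (λ j → f (y ∙ u j) - f y)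
          (λ j → ℤ.i≤j⇒i-j≤0 (ℤ.≤-trans (≤max j) (ℤ.≤-reflexive (≡.sym eq)))) 0≤s i)) eq) >>= λ eq′ →
      f-cong (sym (assoc y (u i) (evaluate w))) >>= λ eq″ →
      pure (≡.trans eq″ eq′)

    constant : ∀ y y′ → ◇ (f y ≡ f y′)
    constant y y′ = maximum >>= λ (y* , max) → value max y >>= λ eq → value max y′ >>= λ eq′ →
      pure (≡.trans eq (≡.sym eq′))
      where
      value : ∀ {y*} → IsMax y* → ∀ y → ◇ (f y ≡ f y*)
      value {y*} max y = spread max (proj₁ w) y* ≡.refl >>= λ eq →
        f-cong (trans (∙-congˡ (proj₂ w)) (solve 2 (λ a b → a ⊕ (a ⊖¹ ⊕ b) ⊜ b) refl y* y)) >>= λ eq′ →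
        pure (≡.trans (≡.sym eq′) eq)
        where w = gen (y* ⁻¹ ∙ y)

-- Bounded harmonic integer cocycles vanish

module BoundedCocycle {t} (T : Set t) (G : Group c ℓ) (nil : IsNilpotent G)
  {m} (u : Fin m → Group.Carrier G) (gen : Words.Generating G u) where
  open Group G hiding (_-_)
  open GroupSolver G
  open Nilpotent G using (UpperCentral-normal)
  open Classical T

  module _ (D : Carrier → Carrier → ℤ)
    (D-cong : ∀ {x x′ y y′} → x ≈ x′ → y ≈ y′ → ◇ (D x y ≡ D x′ y′))
    (D-ε : ∀ x → ◇ (D x ε ≡ 0ℤ))
    (cocycle : ∀ x y z → ◇ (D x y + D (x ∙ y) z ≡ D y z + D x (y ∙ z)))
    (harmonic : ∀ x → ◇ (sum (λ i → D x (u i)) ≡ 0ℤ))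
    (bounded : ∀ y → Σ ℕ λ B → ∀ x → ∣ D x y ∣ ℕ.≤ B) where

    module Step {i} (additive : ∀ z → UpperCentral G i z → ∀ x y → ◇ (D x (y ∙ z) ≡ D x y + D x z))
      z (zz : UpperCentral G (suc i) z) (x : Carrier) where

      -- In this form boundedness is visible, since `D` is bounded in its first argument. The form
      -- in `g-increment` is the one whose Laplacian can be computed.
      g : Carrier → ℤ
      g y = D (x ∙ y) z - D y z

      g-cong : ∀ {y y′} → y ≈ y′ → ◇ (g y ≡ g y′)
      g-cong y≈y′ = D-cong (∙-congˡ y≈y′) refl >>= λ eq → D-cong y≈y′ refl >>= λ eq′ → pure (≡.cong₂ _-_ eq eq′)

      g-increment : ∀ y → ◇ (g y ≡ D x (y ∙ z) - D x y)
      g-increment y = cocycle x y z >>= λ eq → pure (rearranged (D x y) _ _ _ eq)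
        where
        lemma₁ : ∀ a b c → b - c ≡ (a + b) - (a + c)
        lemma₁ = solve-∀
        lemma₂ : ∀ a c d → (c + d) - (a + c) ≡ d - a
        lemma₂ = solve-∀
        rearranged : ∀ a b c d → a + b ≡ c + d → b - c ≡ d - a
        rearranged a b c d eq = ≡.trans (lemma₁ a b c) (≡.trans (≡.cong (_- (a + c)) eq) (lemma₂ a c d))

      commutator : Fin m → Carrier
      commutator j = comm G (u j) z

      drift : ℤ
      drift = sum λ j → D x (commutator j)

      -- Moving `z` past `u j` costs the commutator [u_j, z], which lies one step lower in the
      -- central series, so additivity splits it off. Two uses of the cocycle identity turn the rest
      -- into values D(·, u_j), whose sums over `j` vanish by harmonicity.
      g-step : ∀ y j → ◇ (g (y ∙ u j) - g y ≡
        (D (x ∙ (y ∙ z)) (u j) - D (y ∙ z) (u j)) + D x (commutator j) - (D (x ∙ y) (u j) - D y (u j)))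
      g-step y j =
        g-increment (y ∙ u j) >>= λ e₁ →
        g-increment y >>= λ e₂ →
        D-cong {x = x} refl (solve 3 (λ y z u → (y ⊕ u) ⊕ z ⊜ ((y ⊕ z) ⊕ u) ⊕ commᴱ u z) refl y z (u j)) >>= λ e₃ →
        additive (commutator j) central x (y ∙ z ∙ u j) >>= λ e₄ →
        cocycle x (y ∙ z) (u j) >>= λ e₅ →
        cocycle x y (u j) >>= λ e₆ →
        pure (≡.trans (≡.cong₂ _-_ (≡.trans e₁ (≡.cong (_- D x (y ∙ u j)) (≡.trans e₃ e₄))) e₂)
          (rearranged (D x (y ∙ z)) _ (D (y ∙ z) (u j)) (D x (y ∙ z ∙ u j))
            (D x y) _ (D y (u j)) (D x (y ∙ u j)) _ e₅ e₆))
        where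
        open IsNormal (UpperCentral-normal i)
        central : UpperCentral G i (commutator j)
        central = resp (solve 2 (λ z u → commᴱ z u ⊖¹ ⊜ commᴱ u z) refl z (u j)) (has-⁻¹ (zz (u j)))
        lemma₁ : ∀ a₁ c₁ d₁ a₂ c₂ d₂ k → (d₁ + k - d₂) - (a₁ - a₂) ≡ ((c₁ + d₁) - a₁ - c₁) + k - ((c₂ + d₂) - a₂ - c₂)
        lemma₁ = solve-∀
        lemma₂ : ∀ a₁ b₁ c₁ a₂ b₂ c₂ k → ((a₁ + b₁) - a₁ - c₁) + k - ((a₂ + b₂) - a₂ - c₂) ≡ (b₁ - c₁) + k - (b₂ - c₂)
        lemma₂ = solve-∀
        rearranged : ∀ a₁ b₁ c₁ d₁ a₂ b₂ c₂ d₂ k → a₁ + b₁ ≡ c₁ + d₁ → a₂ + b₂ ≡ c₂ + d₂ →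
          (d₁ + k - d₂) - (a₁ - a₂) ≡ (b₁ - c₁) + k - (b₂ - c₂)
        rearranged a₁ b₁ c₁ d₁ a₂ b₂ c₂ d₂ k eq₁ eq₂ = ≡.trans (lemma₁ a₁ c₁ d₁ a₂ c₂ d₂ k)
          (≡.trans (≡.sym (≡.cong₂ (λ s₁ s₂ → (s₁ - a₁ - c₁) + k - (s₂ - a₂ - c₂)) eq₁ eq₂))
            (lemma₂ a₁ b₁ c₁ a₂ b₂ c₂ k))

      constant-drift : ∀ y → ◇ (sum (λ j → g (y ∙ u j) - g y) ≡ drift)
      constant-drift y =
        ◇-Fin (g-step y) >>= λ steps →
        harmonic (x ∙ (y ∙ z)) >>= λ e₁ →
        harmonic (y ∙ z) >>= λ e₂ →
        harmonic (x ∙ y) >>= λ e₃ →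
        harmonic y >>= λ e₄ →
        pure (≡.trans (sum-cong-≗ steps) (≡.trans (split _ _ (λ j → D x (commutator j)) _ _)
          (≡.trans (≡.cong₂ (λ s s′ → s + drift - s′) (≡.cong₂ _-_ e₁ e₂) (≡.cong₂ _-_ e₃ e₄)) (trivial drift))))
        where
        trivial : ∀ k → (0ℤ - 0ℤ) + k - (0ℤ - 0ℤ) ≡ k
        trivial = solve-∀
        interchange : ∀ a b k c d a′ b′ k′ c′ d′ →
          ((a - b) + k - (c - d)) + ((a′ - b′) + k′ - (c′ - d′)) ≡
          ((a + a′) - (b + b′)) + (k + k′) - ((c + c′) - (d + d′))
        interchange = solve-∀
        split : ∀ {n} (a b k c d : Vector ℤ n) →
          sum (λ j → (a j - b j) + k j - (c j - d j)) ≡ (sum a - sum b) + sum k - (sum c - sum d)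
        split {zero}  a b k c d = ≡.refl
        split {suc n} a b k c d = ≡.trans
          (≡.cong (λ s → (a zero - b zero) + k zero - (c zero - d zero) + s)
            (split (λ j → a (suc j)) (λ j → b (suc j)) (λ j → k (suc j)) (λ j → c (suc j)) (λ j → d (suc j))))
          (interchange (a zero) (b zero) (k zero) (c zero) (d zero) _ _ _ _ _)

      Bz = proj₁ (bounded z)

      ∣g∣≤ : ∀ y → ∣ g y ∣ ℕ.≤ Bz ℕ.+ Bz
      ∣g∣≤ y = ℕ.≤-trans (ℤ.∣i-j∣≤∣i∣+∣j∣ (D (x ∙ y) z) (D y z))
        (ℕ.+-mono-≤ (proj₂ (bounded z) (x ∙ y)) (proj₂ (bounded z) y))

      open MaximumPrinciple T G u gen

      -- A constant Laplacian has a sign: according to it, `g` or its negative is subharmonic, and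
      -- both are bounded above.
      g-constant : ∀ y y′ → ◇ (g y ≡ g y′)
      g-constant with 0ℤ ℤ.≤? drift
      ... | yes 0≤drift = constant g (+ (Bz ℕ.+ Bz)) (λ y → ℤ.≤-trans (i≤∣i∣ (g y)) (ℤ.+≤+ (∣g∣≤ y))) g-cong
            λ y → constant-drift y >>= λ eq → pure (≡.subst (0ℤ ≤_) (≡.sym eq) 0≤drift)
      ... | no 0≰drift = λ y y′ → constant (λ y → - g y) (+ (Bz ℕ.+ Bz))
            (λ y → ℤ.≤-trans (i≤∣i∣ (- g y)) (ℤ.+≤+ (≡.subst (ℕ._≤ Bz ℕ.+ Bz) (≡.sym (ℤ.∣-i∣≡∣i∣ (g y))) (∣g∣≤ y))))
            (λ y≈y′ → g-cong y≈y′ >>= λ eq → pure (≡.cong -_ eq))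
            (λ y → constant-drift y >>= λ eq → pure (≡.subst (0ℤ ≤_)
              (≡.sym (≡.trans (sum-cong-≗ λ j → neg-diff (g (y ∙ u j)) (g y))
                (≡.trans (sum-neg λ j → g (y ∙ u j) - g y) (≡.cong -_ eq))))
              (ℤ.neg-mono-≤ (ℤ.<⇒≤ (ℤ.≰⇒> 0≰drift))))) y y′ >>= λ eq → pure (ℤ.neg-injective eq)
        where
        neg-diff : ∀ a b → - a - - b ≡ - (a - b)
        neg-diff = solve-∀

      additive-suc : ∀ y → ◇ (D x (y ∙ z) ≡ D x y + D x z)
      additive-suc y =
        -- Comparison with the identity is enough: the increment there is D(x,z) - D(x,1) = D(x,z).
        g-constant y ε >>= λ e₁ →
        g-increment y >>= λ e₂ →
        g-increment ε >>= λ e₃ →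
        D-cong {x = x} refl (identityˡ z) >>= λ e₄ →
        D-ε x >>= λ e₅ →
        pure (rearranged _ _ _ (≡.trans (≡.sym e₂) (≡.trans e₁ (≡.trans e₃ (≡.cong₂ _-_ e₄ e₅)))))
        where
        lemma₁ : ∀ a b → a ≡ b + (a - b)
        lemma₁ = solve-∀
        rearranged : ∀ a b k → a - b ≡ k - 0ℤ → a ≡ b + k
        rearranged a b k eq = ≡.trans (lemma₁ a b) (≡.cong (λ s → b + s) (≡.trans eq (ℤ.+-identityʳ k)))

    additive-centralʳ : ∀ i z → UpperCentral G i z → ∀ x y → ◇ (D x (y ∙ z) ≡ D x y + D x z)
    additive-centralʳ zero z (lift z≈ε) x y =
      D-cong {x = x} refl (trans (∙-congˡ z≈ε) (identityʳ y)) >>= λ e₁ →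
      D-cong {x = x} refl z≈ε >>= λ e₂ →
      D-ε x >>= λ e₃ →
      pure (≡.trans e₁ (≡.sym (≡.trans (≡.cong (λ s → D x y + s) (≡.trans e₂ e₃)) (ℤ.+-identityʳ (D x y)))))
    additive-centralʳ (suc i) z zz x y = Step.additive-suc {i} (additive-centralʳ i) z zz x y

    additiveʳ : ∀ x y z → ◇ (D x (y ∙ z) ≡ D x y + D x z)
    additiveʳ x y z = additive-centralʳ (proj₁ nil) z (proj₂ nil z) x y

    -- Once D(x,yz) is expanded in the cocycle identity, D(x,y) cancels from both sides.
    additiveˡ : ∀ x y z → ◇ (D (x ∙ y) z ≡ D x z + D y z)
    additiveˡ x y z = additiveʳ x y z >>= λ e₁ → cocycle x y z >>= λ e₂ →
      pure (+-cancelˡ (D x y) _ _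
        (≡.trans e₂ (≡.trans (≡.cong (λ s → D y z + s) e₁) (shuffle (D y z) (D x y) (D x z)))))
      where
      shuffle : ∀ a b c → a + (b + c) ≡ b + (c + a)
      shuffle = solve-∀

    D-pow : ∀ n x y → ◇ (D (pow G n x) y ≡ + n * D x y)
    D-pow zero    x y = additiveˡ ε ε y >>= λ e₁ → D-cong {y = y} (identityˡ ε) refl >>= λ e₂ →
      pure (≡.trans (+-cancelˡ (D ε y) _ _ (≡.trans (≡.trans (≡.sym e₁) e₂) (≡.sym (ℤ.+-identityʳ (D ε y)))))
        (≡.sym (ℤ.*-zeroˡ (D x y))))
    D-pow (suc n) x y = additiveˡ x (pow G n x) y >>= λ e₁ → D-pow n x y >>= λ e₂ →
      pure (≡.trans e₁ (≡.trans (≡.cong (λ s → D x y + s) e₂) (≡.sym (ℤ.suc-* (+ n) (D x y)))))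

    vanishes : ∀ x y → ◇ (D x y ≡ 0ℤ)
    -- The exponent exceeds the bound by one, so multiplying a nonzero value by it would overshoot
    -- `B`.
    vanishes x y = by-cases (D x y ℤ.≟ 0ℤ) λ d≢0 → D-pow (suc B) x y λ eq → contradiction (begin
        suc B                          ≤⟨ ℕ.m≤m*n (suc B) ∣ D x y ∣ {{ℕ.≢-nonZero λ eq → d≢0 (ℤ.∣i∣≡0⇒i≡0 eq)}} ⟩
        suc B ℕ.* ∣ D x y ∣            ≡⟨ ℤ.abs-* (+ suc B) (D x y) ⟨
        ∣ + suc B * D x y ∣            ≡⟨ ≡.cong ∣_∣ eq ⟨
        ∣ D (pow G (suc B) x) y ∣      ≤⟨ proj₂ (bounded y) _ ⟩
        B                              ∎) (ℕ.<⇒≱ ℕ.≤-refl)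
      where
      open ℕ.≤-Reasoning
      B = proj₁ (bounded y)

-- Integer powers and integer combinations in abelian groups

dot-+ : ∀ {n} (l k k′ : Vector ℤ n) → dot l (λ i → k i + k′ i) ≡ dot l k + dot l k′
dot-+ l k k′ = ≡.trans (sum-cong-≗ λ i → ℤ.*-distribˡ-+ (l i) (k i) (k′ i))
  (∑-distrib-+ (λ i → l i * k i) λ i → l i * k′ i)

dot-neg : ∀ {n} (l k : Vector ℤ n) → dot l (λ i → - k i) ≡ - dot l k
dot-neg l k = ≡.trans (sum-cong-≗ λ i → ≡.sym (ℤ.neg-distribʳ-* (l i) (k i))) (sum-neg λ i → l i * k i)

dot-minus : ∀ {n} (l k k′ : Vector ℤ n) → dot l (λ i → k i - k′ i) ≡ dot l k - dot l k′
dot-minus l k k′ = ≡.trans (dot-+ l k λ i → - k′ i) (≡.cong (λ s → dot l k + s) (dot-neg l k′))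

unit : ∀ {n} → Fin n → Vector ℤ n
unit zero    = 1ℤ ◂ λ _ → 0ℤ
unit (suc j) = 0ℤ ◂ unit j

dot-zeroʳ : ∀ {n} (l : Vector ℤ n) → dot l (λ _ → 0ℤ) ≡ 0ℤ
dot-zeroʳ {n} l = ≡.trans (sum-cong-≗ {n} λ i → ℤ.*-zeroʳ (l i)) (sum-zero {n})

dot-unit : ∀ {n} (l : Vector ℤ n) j → dot l (unit j) ≡ l j
dot-unit l zero    = ≡.trans (≡.cong₂ _+_ (ℤ.*-identityʳ (l zero)) (dot-zeroʳ λ i → l (suc i)))
  (ℤ.+-identityʳ (l zero))
dot-unit l (suc j) = ≡.trans (≡.cong₂ _+_ (ℤ.*-zeroʳ (l zero)) (dot-unit (λ i → l (suc i)) j))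
  (ℤ.+-identityˡ (l (suc j)))

module IntegerPowers (G : Group c ℓ) where
  open Group G hiding (_-_)
  open GroupSolver G
  open Powers G
  open SetoidReasoning setoid

  zpow : ℤ → Carrier → Carrier
  zpow (+ n)    x = pow G n x
  zpow -[1+ n ] x = pow G (suc n) x ⁻¹

  zpow-⊖ : ∀ m n x → zpow (m ⊖ n) x ≈ pow G m x ∙ pow G n x ⁻¹
  zpow-⊖ m       zero    x = solve 1 (λ p → p ⊜ p ⊕ ε̂ ⊖¹) refl (pow G m x)
  zpow-⊖ zero    (suc n) x = sym (identityˡ _)
  zpow-⊖ (suc m) (suc n) x = begin
    zpow (suc m ⊖ suc n) x                ≡⟨ ≡.cong (λ i → zpow i x) (ℤ.[1+m]⊖[1+n]≡m⊖n m n) ⟩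
    zpow (m ⊖ n) x                        ≈⟨ zpow-⊖ m n x ⟩
    p ∙ q ⁻¹                              ≈⟨ solve 3 (λ x p q → p ⊕ q ⊖¹ ⊜ p ⊕ x ⊕ (q ⊕ x) ⊖¹) refl x p q ⟩
    p ∙ x ∙ (q ∙ x) ⁻¹                    ≈⟨ ∙-cong (pow-commute m refl) (⁻¹-cong (pow-commute n refl)) ⟩
    x ∙ p ∙ (x ∙ q) ⁻¹                    ∎
    where
    p = pow G m x
    q = pow G n x

  pow-pow-commute : ∀ m n x → pow G m x ∙ pow G n x ≈ pow G n x ∙ pow G m x
  pow-pow-commute m n x = pow-commute m (sym (pow-commute n refl))

  zpow-+ : ∀ i j x → zpow (i + j) x ≈ zpow i x ∙ zpow j x
  zpow-+ (+ m)    (+ n)    x = pow-+ m n x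
  zpow-+ (+ m)    -[1+ n ] x = zpow-⊖ m (suc n) x
  zpow-+ -[1+ m ] (+ n)    x = begin
    zpow (n ⊖ suc m) x      ≈⟨ zpow-⊖ n (suc m) x ⟩
    q ∙ p ⁻¹                ≈⟨ solve 2 (λ p q → q ⊕ p ⊖¹ ⊜ p ⊖¹ ⊕ (p ⊕ q) ⊕ p ⊖¹) refl p q ⟩
    p ⁻¹ ∙ (p ∙ q) ∙ p ⁻¹   ≈⟨ ∙-congʳ (∙-congˡ (pow-pow-commute (suc m) n x)) ⟩
    p ⁻¹ ∙ (q ∙ p) ∙ p ⁻¹   ≈⟨ solve 2 (λ p q → p ⊖¹ ⊕ (q ⊕ p) ⊕ p ⊖¹ ⊜ p ⊖¹ ⊕ q) refl p q ⟩
    p ⁻¹ ∙ q                ∎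
    where
    p = pow G (suc m) x
    q = pow G n x
  zpow-+ -[1+ m ] -[1+ n ] x = begin
    pow G (suc (suc (m ℕ.+ n))) x ⁻¹  ≡⟨ ≡.cong (λ k → pow G (suc k) x ⁻¹) 1+m+n≡n+1+m ⟩
    pow G (suc n ℕ.+ suc m) x ⁻¹      ≈⟨ ⁻¹-cong (pow-+ (suc n) (suc m) x) ⟩
    (q ∙ p) ⁻¹                        ≈⟨ solve 2 (λ p q → (q ⊕ p) ⊖¹ ⊜ p ⊖¹ ⊕ q ⊖¹) refl p q ⟩
    p ⁻¹ ∙ q ⁻¹                       ∎
    where
    p = pow G (suc m) x
    q = pow G (suc n) x
    1+m+n≡n+1+m : suc (m ℕ.+ n) ≡ n ℕ.+ suc m
    1+m+n≡n+1+m = ≡.trans (≡.cong suc (ℕ.+-comm m n)) (≡.sym (ℕ.+-suc n m))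

  zpow-neg : ∀ i x → zpow (- i) x ≈ zpow i x ⁻¹
  zpow-neg (+ zero)  x = solve 0 (ε̂ ⊜ ε̂ ⊖¹) refl
  zpow-neg (+ suc n) x = refl
  zpow-neg -[1+ n ]  x = solve 1 (λ p → p ⊜ (p ⊖¹) ⊖¹) refl (pow G (suc n) x)

  zpow-torsion : ∀ i {x} → i ≢ 0ℤ → zpow i x ≈ ε → IsTorsion G x
  zpow-torsion (+ zero)  i≢0 eq = contradiction ≡.refl i≢0
  zpow-torsion (+ suc n) i≢0 eq = n , eq
  zpow-torsion -[1+ n ] {x} i≢0 eq = n , trans (solve 1 (λ p → p ⊜ (p ⊖¹) ⊖¹) refl (pow G (suc n) x))
    (trans (⁻¹-cong eq) (solve 0 (ε̂ ⊖¹ ⊜ ε̂) refl))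

module LinearCombinations (A : AbelianGroup c ℓ) where
  open AbelianGroup A hiding (_-_)
  open GroupSolver group
  open IntegerPowers group
  open AbelianGroupProperties A using (⁻¹-∙-comm)
  open CommutativeSemigroupProperties (CommutativeMonoid.commutativeSemigroup commutativeMonoid) using (interchange)
  open SetoidReasoning setoid

  combination : ∀ {n} → Vector Carrier n → Vector ℤ n → Carrier
  combination {zero}  a k = ε
  combination {suc n} a k = zpow (k zero) (a zero) ∙ combination (λ i → a (suc i)) (λ i → k (suc i))

  combination-cong : ∀ {n} (a : Vector Carrier n) {k k′} → k ≗ k′ → combination a k ≈ combination a k′
  combination-cong {zero}  a eq = refl
  combination-cong {suc n} a eq = ∙-cong (reflexive (≡.cong (λ i → zpow i (a zero)) (eq zero)))
    (combination-cong _ λ i → eq (suc i))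

  combination-zero : ∀ {n} (a : Vector Carrier n) → combination a (λ _ → 0ℤ) ≈ ε
  combination-zero {zero}  a = refl
  combination-zero {suc n} a = trans (identityˡ _) (combination-zero λ i → a (suc i))

  combination-+ : ∀ {n} (a : Vector Carrier n) k k′ →
    combination a (λ i → k i + k′ i) ≈ combination a k ∙ combination a k′
  combination-+ {zero}  a k k′ = sym (identityˡ ε)
  combination-+ {suc n} a k k′ = trans
    (∙-cong (zpow-+ (k zero) (k′ zero) (a zero)) (combination-+ (λ i → a (suc i)) (λ i → k (suc i)) (λ i → k′ (suc i))))
    (interchange _ _ _ _)

  combination-neg : ∀ {n} (a : Vector Carrier n) k → combination a (λ i → - k i) ≈ combination a k ⁻¹
  combination-neg {zero}  a k = solve 0 (ε̂ ⊜ ε̂ ⊖¹) refl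
  combination-neg {suc n} a k = trans
    (∙-cong (zpow-neg (k zero) (a zero)) (combination-neg (λ i → a (suc i)) λ i → k (suc i)))
    (⁻¹-∙-comm _ _)

  combination-minus : ∀ {n} (a : Vector Carrier n) k k′ →
    combination a (λ i → k i - k′ i) ≈ combination a k ∙ combination a k′ ⁻¹
  combination-minus a k k′ = trans (combination-+ a k λ i → - k′ i) (∙-congˡ (combination-neg a k′))

  combination-scale-ℕ : ∀ {n} (a : Vector Carrier n) m k →
    combination a (λ i → + m * k i) ≈ pow group m (combination a k)
  combination-scale-ℕ a zero    k = trans (combination-cong a λ i → ℤ.*-zeroˡ (k i)) (combination-zero a)
  combination-scale-ℕ a (suc m) k = begin
    combination a (λ i → + suc m * k i)               ≈⟨ combination-cong a (λ i → ℤ.suc-* (+ m) (k i)) ⟩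
    combination a (λ i → k i + + m * k i)             ≈⟨ combination-+ a k _ ⟩
    combination a k ∙ combination a (λ i → + m * k i) ≈⟨ ∙-congˡ (combination-scale-ℕ a m k) ⟩
    combination a k ∙ pow group m (combination a k)   ∎

  combination-scale : ∀ {n} (a : Vector Carrier n) b k → combination a (λ i → b * k i) ≈ zpow b (combination a k)
  combination-scale a (+ m)    k = combination-scale-ℕ a m k
  combination-scale a -[1+ m ] k = begin
    combination a (λ i → -[1+ m ] * k i)        ≈⟨ combination-cong a (λ i → ≡.sym (ℤ.neg-distribˡ-* (+ suc m) (k i))) ⟩
    combination a (λ i → - (+ suc m * k i))     ≈⟨ combination-neg a _ ⟩
    combination a (λ i → + suc m * k i) ⁻¹      ≈⟨ ⁻¹-cong (combination-scale-ℕ a (suc m) k) ⟩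
    pow group (suc m) (combination a k) ⁻¹      ∎

  combination-unit : ∀ {n} (a : Vector Carrier n) j → combination a (unit j) ≈ a j
  combination-unit a zero    = trans (∙-cong (identityʳ _) (combination-zero λ i → a (suc i))) (identityʳ _)
  combination-unit a (suc j) = trans (identityˡ _) (combination-unit (λ i → a (suc i)) j)

  zpow-ε : ∀ b {x} → x ≈ ε → zpow b x ≈ ε
  zpow-ε (+ n)    x≈ε = trans (Powers.pow-cong group n x≈ε) (Powers.pow-ε group n)
  zpow-ε -[1+ n ] x≈ε = trans
    (⁻¹-cong (trans (Powers.pow-cong group (suc n) x≈ε) (Powers.pow-ε group (suc n))))
    (solve 0 (ε̂ ⊖¹ ⊜ ε̂) refl)

  relations : ∀ {n} (a : Vector Carrier n) → IsSubgroup λ k → combination a k ≈ ε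
  relations a = record
    { resp     = λ eq → trans (sym (combination-cong a eq))
    ; has-zero = combination-zero a
    ; has-comb = λ b b′ {k} {k′} eq eq′ → begin
        combination a (comb b k b′ k′)
          ≈⟨ combination-minus a _ _ ⟩
        combination a (λ i → b * k i) ∙ combination a (λ i → b′ * k′ i) ⁻¹
          ≈⟨ ∙-cong (combination-scale a b k) (⁻¹-cong (combination-scale a b′ k′)) ⟩
        zpow b (combination a k) ∙ zpow b′ (combination a k′) ⁻¹
          ≈⟨ ∙-cong (zpow-ε b eq) (⁻¹-cong (zpow-ε b′ eq′)) ⟩
        ε ∙ ε ⁻¹
          ≈⟨ inverseʳ ε ⟩
        ε ∎
    }

-- The centre and central potentials

module Centre (G : Group c ℓ) where
  open Group G
  open GroupSolver G
  open SetoidReasoning setoid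

  IsCentral : Carrier → Set (c ⊔ ℓ)
  IsCentral z = ∀ y → z ∙ y ≈ y ∙ z

  central-cong : ∀ {x y} → x ≈ y → IsCentral x → IsCentral y
  central-cong x≈y cx w = trans (∙-congʳ (sym x≈y)) (trans (cx w) (∙-congˡ x≈y))

  central-ε : IsCentral ε
  central-ε y = trans (identityˡ y) (sym (identityʳ y))

  central-∙ : ∀ {x y} → IsCentral x → IsCentral y → IsCentral (x ∙ y)
  central-∙ {x} {y} cx cy w = begin
    x ∙ y ∙ w   ≈⟨ assoc x y w ⟩
    x ∙ (y ∙ w) ≈⟨ ∙-congˡ (cy w) ⟩
    x ∙ (w ∙ y) ≈⟨ assoc x w y ⟨
    x ∙ w ∙ y   ≈⟨ ∙-congʳ (cx w) ⟩
    w ∙ x ∙ y   ≈⟨ assoc w x y ⟩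
    w ∙ (x ∙ y) ∎

  central-⁻¹ : ∀ {x} → IsCentral x → IsCentral (x ⁻¹)
  central-⁻¹ {x} cx w = begin
    x ⁻¹ ∙ w                  ≈⟨ solve 2 (λ x w → x ⊖¹ ⊕ w ⊜ x ⊖¹ ⊕ (w ⊕ x) ⊕ x ⊖¹) refl x w ⟩
    x ⁻¹ ∙ (w ∙ x) ∙ x ⁻¹     ≈⟨ ∙-congʳ (∙-congˡ (cx w)) ⟨
    x ⁻¹ ∙ (x ∙ w) ∙ x ⁻¹     ≈⟨ solve 2 (λ x w → x ⊖¹ ⊕ (x ⊕ w) ⊕ x ⊖¹ ⊜ w ⊕ x ⊖¹) refl x w ⟩
    w ∙ x ⁻¹                  ∎

  -- A record rather than proj₁ x ≈ proj₁ y, so that x and y can be inferred from their equality.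
  record _≈ᶜ_ (x y : Σ Carrier IsCentral) : Set ℓ where
    constructor mk≈ᶜ
    field underlying : proj₁ x ≈ proj₁ y

  centre : AbelianGroup (c ⊔ ℓ) ℓ
  centre = record
    { Carrier = Σ Carrier IsCentral
    ; _≈_ = _≈ᶜ_
    ; _∙_ = λ (x , cx) (y , cy) → x ∙ y , central-∙ cx cy
    ; ε = ε , central-ε
    ; _⁻¹ = λ (x , cx) → x ⁻¹ , central-⁻¹ cx
    ; isAbelianGroup = record
      { isGroup = record
        { isMonoid = record
          { isSemigroup = record
            { isMagma = record
              { isEquivalence = record
                { refl = mk≈ᶜ (refl)
                ; sym = λ (mk≈ᶜ eq) → mk≈ᶜ (sym eq)
                ; trans = λ (mk≈ᶜ eq) (mk≈ᶜ eq′) → mk≈ᶜ (trans eq eq′)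
                }
              ; ∙-cong = λ (mk≈ᶜ eq) (mk≈ᶜ eq′) → mk≈ᶜ (∙-cong eq eq′)
              }
            ; assoc = λ x y z → mk≈ᶜ (assoc _ _ _)
            }
          ; identity = (λ x → mk≈ᶜ (identityˡ _)) , λ x → mk≈ᶜ (identityʳ _)
          }
        ; inverse = (λ x → mk≈ᶜ (inverseˡ _)) , λ x → mk≈ᶜ (inverseʳ _)
        ; ⁻¹-cong = λ (mk≈ᶜ eq) → mk≈ᶜ (⁻¹-cong eq)
        }
      ; comm = λ (x , cx) (y , cy) → mk≈ᶜ (cx y)
      }
    }

  pow-centre : ∀ n z → proj₁ (pow (AbelianGroup.group centre) n z) ≡ pow G n (proj₁ z)
  pow-centre zero    z = ≡.refl
  pow-centre (suc n) z = ≡.cong (proj₁ z ∙_) (pow-centre n z)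

  torsion-centre : ∀ {z} → IsTorsion (AbelianGroup.group centre) z → IsTorsion G (proj₁ z)
  torsion-centre {z} (n , mk≈ᶜ eq) = n , trans (reflexive (≡.sym (pow-centre (suc n) z))) eq

  -- v j = b j ∙ a j where b j is a common representative of the coset of v j modulo the centre.
  potentials : ∀ {t} (T : Set t) {n} (v : Fin n → Carrier) →
    Classical.◇ T (Σ (Fin n → Σ Carrier IsCentral) λ a →
       ∀ j k → IsCentral (v j ⁻¹ ∙ v k) → Classical.◇ T (v j ⁻¹ ∙ v k ≈ proj₁ (a j) ⁻¹ ∙ proj₁ (a k)))
  potentials T {zero}  v = Classical.pure T ((λ ()) , λ ())
  potentials T {suc n} v = potentials T (λ i → v (suc i)) >>= λ (a , pot) →
    excluded-middle (Σ (Fin n) λ k → IsCentral (v zero ⁻¹ ∙ v (suc k))) >>= λ where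
      -- The new potential is solved from the required identity with the partner `k`; every other
      -- `l` in the coset follows by passing through `k`.
      (inj₁ (k , ck)) → extend a pot
        (proj₁ (a k) ∙ (v zero ⁻¹ ∙ v (suc k)) ⁻¹ , central-∙ (proj₂ (a k)) (central-⁻¹ ck))
        λ l cl → pot k l (central-cong (solve 3 (λ x y z → (x ⊖¹ ⊕ y) ⊖¹ ⊕ (x ⊖¹ ⊕ z) ⊜ y ⊖¹ ⊕ z) refl _ _ _)
            (central-∙ (central-⁻¹ ck) cl)) >>= λ eq →
          pure (begin
            v zero ⁻¹ ∙ v (suc l)
              ≈⟨ solve 3 (λ x y z → x ⊖¹ ⊕ z ⊜ x ⊖¹ ⊕ y ⊕ (y ⊖¹ ⊕ z)) refl (v zero) (v (suc k)) (v (suc l)) ⟩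
            v zero ⁻¹ ∙ v (suc k) ∙ (v (suc k) ⁻¹ ∙ v (suc l))
              ≈⟨ ∙-congˡ eq ⟩
            v zero ⁻¹ ∙ v (suc k) ∙ (proj₁ (a k) ⁻¹ ∙ proj₁ (a l))
              ≈⟨ solve 3 (λ w x z → w ⊕ (x ⊖¹ ⊕ z) ⊜ (x ⊕ w ⊖¹) ⊖¹ ⊕ z) refl
                   (v zero ⁻¹ ∙ v (suc k)) (proj₁ (a k)) (proj₁ (a l)) ⟩
            (proj₁ (a k) ∙ (v zero ⁻¹ ∙ v (suc k)) ⁻¹) ⁻¹ ∙ proj₁ (a l) ∎)
      -- The coset is new, so the identity is a mere default: any partner `l` would contradict
      -- `none`.
      (inj₂ none) → extend a pot (ε , central-ε) λ l cl _ → none (l , cl)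
    where
    open Classical T
    extend : ∀ a → (∀ j k → IsCentral (v (suc j) ⁻¹ ∙ v (suc k)) →
        ◇ (v (suc j) ⁻¹ ∙ v (suc k) ≈ proj₁ (a j) ⁻¹ ∙ proj₁ (a k))) →
      ∀ a₀ → (∀ k → IsCentral (v zero ⁻¹ ∙ v (suc k)) → ◇ (v zero ⁻¹ ∙ v (suc k) ≈ proj₁ a₀ ⁻¹ ∙ proj₁ (a k))) →
      ◇ (Σ (Fin (suc n) → Σ Carrier IsCentral) λ a →
         ∀ j k → IsCentral (v j ⁻¹ ∙ v k) → ◇ (v j ⁻¹ ∙ v k ≈ proj₁ (a j) ⁻¹ ∙ proj₁ (a k)))
    extend a pot a₀ pot₀ = pure (a₀ ◂ a , λ where
        zero    zero    _ → pure (trans (inverseˡ _) (sym (inverseˡ _)))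
        zero    (suc k) ck → pot₀ k ck
        (suc j) zero    cj → pot₀ j (central-cong (flip (v (suc j)) (v zero)) (central-⁻¹ cj)) >>= λ eq →
          pure (trans (sym (flip (v zero) (v (suc j)))) (trans (⁻¹-cong eq) (flip (proj₁ a₀) (proj₁ (a j)))))
        (suc j) (suc k) c → pot j k c)
      where
      flip : ∀ x y → (x ⁻¹ ∙ y) ⁻¹ ≈ y ⁻¹ ∙ x
      flip x y = solve 2 (λ x y → (x ⊖¹ ⊕ y) ⊖¹ ⊜ y ⊖¹ ⊕ x) refl x y

-- From a central defect to an integer cocycle

uniform-bound : ∀ {n} (f : Vector ℤ n) → Σ ℕ λ B → ∀ i → ∣ f i ∣ ℕ.≤ B
uniform-bound {zero}  f = 0 , λ ()
uniform-bound {suc n} f with uniform-bound (λ i → f (suc i))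
... | B , ≤B = ∣ f zero ∣ ℕ.+ B , λ where
  zero    → ℕ.m≤m+n ∣ f zero ∣ B
  (suc i) → ℕ.≤-trans (≤B i) (ℕ.m≤n+m B ∣ f zero ∣)

sum-minus : ∀ {n} (f g : Vector ℤ n) → sum (λ i → f i - g i) ≡ sum f - sum g
sum-minus f g = ≡.trans (∑-distrib-+ f λ i → - g i) (≡.cong (λ s → sum f + s) (sum-neg g))

-- The part of a Cayley isomorphism that survives passing to a quotient of the target. The bijection
-- is between indices, so elements of `v` may become equal there without harm, whereas injectivity
-- of `φ` would be lost.
record LocalStructure (T : Set t) (G : Group c₁ ℓ₁) (Q : Group c₂ ℓ₂)
  (φ : Group.Carrier G → Group.Carrier Q) : Set (c₁ ⊔ ℓ₁ ⊔ c₂ ⊔ ℓ₂ ⊔ t) where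
  open Classical T
  private
    module G = Group G
    module Q = Group Q
  field
    {m n} : ℕ
    u : Fin m → G.Carrier
    v : Fin n → Q.Carrier
    generating : Words.Generating G u
    edge : G.Carrier → Fin m → Fin n
    edge-eq : ∀ x i → φ (x G.∙ u i) Q.≈ φ x Q.∙ v (edge x i)
    edge-bijective : ∀ x → ◇ (Σ (Permutation m n) λ π → ∀ i → π ⟨$⟩ʳ i ≡ edge x i)

-- It has the shape a⁻¹b of the equality in `Quotient`, so its being torsion is literally
-- multiplicativity of `φ` modulo torsion.
defect : (G : Group c₁ ℓ₁) (Q : Group c₂ ℓ₂) → (Group.Carrier G → Group.Carrier Q) →
  Group.Carrier G → Group.Carrier G → Group.Carrier Q
defect G Q φ x y = (φ x ∙ φ y) ⁻¹ ∙ φ (x G.∙ y)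
  where
  open Group Q
  module G = Group G

module CentralDefect (G : Group c₁ ℓ₁) (nil : IsNilpotent G) (Q : Group c₂ ℓ₂)
  (φ : Group.Carrier G → Group.Carrier Q)
  (φ-cong : ∀ x y → Group._≈_ G x y → Group._≈_ Q (φ x) (φ y))
  (φ-ε : Group._≈_ Q (φ (Group.ε G)) (Group.ε Q))
  (central : ∀ x y → Centre.IsCentral Q (defect G Q φ x y)) where
  private
    module G = Group G
    module Q where
      open Group Q public
      open GroupSolver Q public
      open Centre Q public
  open AbelianGroup Q.centre
    using (Carrier; _≈_; _∙_; ε; _⁻¹; refl; sym; trans; ∙-cong; ∙-congˡ; ∙-congʳ; ⁻¹-cong; inverseʳ; setoid; group)
    renaming (comm to ∙-comm)
  open IntegerPowers group using (zpow; zpow-torsion)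
  open LinearCombinations Q.centre
  open GroupSolver group using (solve; _⊜_)

  C : G.Carrier → G.Carrier → Carrier
  C x y = defect G Q φ x y , central x y

  C-cong : ∀ {x x′ y y′} → x G.≈ x′ → y G.≈ y′ → C x y ≈ C x′ y′
  C-cong x≈x′ y≈y′ = Q.mk≈ᶜ (Q.∙-cong (Q.⁻¹-cong (Q.∙-cong (φ-cong _ _ x≈x′) (φ-cong _ _ y≈y′)))
    (φ-cong _ _ (G.∙-cong x≈x′ y≈y′)))

  C-ε : ∀ x → C x G.ε ≈ ε
  C-ε x = Q.mk≈ᶜ (Q.trans
    (Q.∙-cong (Q.⁻¹-cong (Q.trans (Q.∙-congˡ φ-ε) (Q.identityʳ _))) (φ-cong _ _ (G.identityʳ x)))
    (Q.inverseˡ _))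

  φ-∙ : ∀ x y → φ (x G.∙ y) Q.≈ φ x Q.∙ φ y Q.∙ proj₁ (C x y)
  φ-∙ x y = Q.solve 3 (λ a b d → d Q.⊜ a ⊕ b ⊕ ((a ⊕ b) ⊖¹ ⊕ d)) Q.refl (φ x) (φ y) (φ (x G.∙ y))

  -- Both sides equal (φ(x)φ(y)φ(z))⁻¹φ(xyz), computed from the two bracketings of xyz; centrality
  -- moves the inner defect past φ(z).
  cocycle : ∀ x y z → C x y ∙ C (x G.∙ y) z ≈ C y z ∙ C x (y G.∙ z)
  cocycle x y z = Q.mk≈ᶜ (begin
    d₁ Q.∙ d₂
      ≈⟨ Q.solve 5 (λ a b d p q → p ⊕ q Q.⊜ (a ⊕ b ⊕ d) ⊖¹ ⊕ (a ⊕ b ⊕ (d ⊕ p) ⊕ q)) Q.refl (φ x) (φ y) (φ z) d₁ d₂ ⟩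
    (φ x Q.∙ φ y Q.∙ φ z) Q.⁻¹ Q.∙ (φ x Q.∙ φ y Q.∙ (φ z Q.∙ d₁) Q.∙ d₂)
      ≈⟨ Q.∙-congˡ (Q.∙-congʳ (Q.∙-congˡ (central x y (φ z)))) ⟨
    (φ x Q.∙ φ y Q.∙ φ z) Q.⁻¹ Q.∙ (φ x Q.∙ φ y Q.∙ (d₁ Q.∙ φ z) Q.∙ d₂)
      ≈⟨ Q.∙-congˡ (Q.∙-congʳ (Q.assoc _ _ _)) ⟨
    (φ x Q.∙ φ y Q.∙ φ z) Q.⁻¹ Q.∙ (φ x Q.∙ φ y Q.∙ d₁ Q.∙ φ z Q.∙ d₂)
      ≈⟨ Q.∙-congˡ (Q.∙-congʳ (Q.∙-congʳ (φ-∙ x y))) ⟨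
    (φ x Q.∙ φ y Q.∙ φ z) Q.⁻¹ Q.∙ (φ (x G.∙ y) Q.∙ φ z Q.∙ d₂)
      ≈⟨ Q.∙-congˡ (φ-∙ (x G.∙ y) z) ⟨
    (φ x Q.∙ φ y Q.∙ φ z) Q.⁻¹ Q.∙ φ (x G.∙ y G.∙ z)
      ≈⟨ Q.∙-congˡ (φ-cong _ _ (G.assoc x y z)) ⟩
    (φ x Q.∙ φ y Q.∙ φ z) Q.⁻¹ Q.∙ φ (x G.∙ (y G.∙ z))
      ≈⟨ Q.∙-congˡ (φ-∙ x (y G.∙ z)) ⟩
    (φ x Q.∙ φ y Q.∙ φ z) Q.⁻¹ Q.∙ (φ x Q.∙ φ (y G.∙ z) Q.∙ d₄)
      ≈⟨ Q.∙-congˡ (Q.∙-congʳ (Q.∙-congˡ (φ-∙ y z))) ⟩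
    (φ x Q.∙ φ y Q.∙ φ z) Q.⁻¹ Q.∙ (φ x Q.∙ (φ y Q.∙ φ z Q.∙ d₃) Q.∙ d₄)
      ≈⟨ Q.solve 5 (λ a b d p q → (a ⊕ b ⊕ d) ⊖¹ ⊕ (a ⊕ (b ⊕ d ⊕ p) ⊕ q) Q.⊜ p ⊕ q) Q.refl (φ x) (φ y) (φ z) d₃ d₄ ⟩
    d₃ Q.∙ d₄ ∎)
    where
    open SetoidReasoning Q.setoid
    d₁ = proj₁ (C x y)
    d₂ = proj₁ (C (x G.∙ y) z)
    d₃ = proj₁ (C y z)
    d₄ = proj₁ (C x (y G.∙ z))

  module Lifting (T : Set t) (local : LocalStructure T G Q φ) where
    open LocalStructure local
    open Classical T
    open Words G u using (evaluate)

    module _ (a : Fin n → Carrier)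
      (potential : ∀ j k → Q.IsCentral (v j Q.⁻¹ Q.∙ v k) → ◇ (v j Q.⁻¹ Q.∙ v k Q.≈ proj₁ (a j ⁻¹ ∙ a k))) where

      word : G.Carrier → List (Fin m)
      word y = proj₁ (generating y)

      -- Since φ(1) = 1, the defect at a generator is the quotient of the elements of `v` that this
      -- generator reaches from the identity and from `x`. Over the potentials its exponent vector
      -- is a difference of two unit vectors.
      jump : G.Carrier → Fin m → Vector ℤ n
      jump x i j = unit (edge x i) j - unit (edge G.ε i) j

      -- The cocycle identity solved for its last term, c(x,uw) = c(x,u) c(xu,w) c(u,w)⁻¹, unrolled
      -- along the word on the level of exponent vectors.
      lift-word : G.Carrier → List (Fin m) → Vector ℤ n
      lift-word x []      j = 0ℤ
      lift-word x (i ∷ w) j = (jump x i j + lift-word (x G.∙ u i) w j) - lift-word (u i) w j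

      C-edge : ∀ x i → proj₁ (C x (u i)) Q.≈ v (edge G.ε i) Q.⁻¹ Q.∙ v (edge x i)
      C-edge x i = Q.trans
        (Q.∙-cong (Q.⁻¹-cong (Q.∙-congˡ φ-u)) (edge-eq x i))
        (Q.solve 3 (λ a b d → (a ⊕ b) ⊖¹ ⊕ (a ⊕ d) Q.⊜ b ⊖¹ ⊕ d) Q.refl (φ x) (v (edge G.ε i)) (v (edge x i)))
        where
        φ-u : φ (u i) Q.≈ v (edge G.ε i)
        φ-u = Q.trans (φ-cong _ _ (G.sym (G.identityˡ (u i))))
          (Q.trans (edge-eq G.ε i) (Q.trans (Q.∙-congʳ φ-ε) (Q.identityˡ _)))

      combination-jump : ∀ x i → ◇ (combination a (jump x i) ≈ C x (u i))
      combination-jump x i =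
        potential (edge G.ε i) (edge x i) (Q.central-cong (C-edge x i) (central x (u i))) >>= λ eq → pure (begin
          combination a (jump x i)
            ≈⟨ combination-minus a _ _ ⟩
          combination a (unit (edge x i)) ∙ combination a (unit (edge G.ε i)) ⁻¹
            ≈⟨ ∙-cong (combination-unit a (edge x i)) (⁻¹-cong (combination-unit a (edge G.ε i))) ⟩
          a (edge x i) ∙ a (edge G.ε i) ⁻¹
            ≈⟨ ∙-comm (a (edge x i)) _ ⟩
          a (edge G.ε i) ⁻¹ ∙ a (edge x i)
            ≈⟨ Q.mk≈ᶜ (Q.trans (C-edge x i) eq) ⟨
          C x (u i) ∎)
        where open SetoidReasoning setoid

      combination-word : ∀ x w → ◇ (combination a (lift-word x w) ≈ C x (evaluate w))
      combination-word x []      = pure (trans (combination-zero a) (sym (C-ε x)))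
      combination-word x (i ∷ w) =
        combination-jump x i >>= λ e₁ →
        combination-word (x G.∙ u i) w >>= λ e₂ →
        combination-word (u i) w >>= λ e₃ →
        pure (begin
          combination a (lift-word x (i ∷ w))
            ≈⟨ trans (combination-minus a _ _) (∙-congʳ (combination-+ a _ _)) ⟩
          combination a (jump x i) ∙ combination a (lift-word (x G.∙ u i) w) ∙ combination a (lift-word (u i) w) ⁻¹
            ≈⟨ ∙-cong (∙-cong e₁ e₂) (⁻¹-cong e₃) ⟩
          C x (u i) ∙ C (x G.∙ u i) y ∙ C (u i) y ⁻¹
            ≈⟨ ∙-congʳ (cocycle x (u i) y) ⟩
          C (u i) y ∙ C x (u i G.∙ y) ∙ C (u i) y ⁻¹
            ≈⟨ ∙-congʳ (∙-comm (C (u i) y) _) ⟩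
          C x (u i G.∙ y) ∙ C (u i) y ∙ C (u i) y ⁻¹
            ≈⟨ solve 2 (λ p q → p ⊕ q ⊕ q ⊖¹ ⊜ p) refl (C x (u i G.∙ y)) (C (u i) y) ⟩
          C x (u i G.∙ y) ∎)
        where
        open SetoidReasoning setoid
        y = evaluate w

      lift-C : G.Carrier → G.Carrier → Vector ℤ n
      lift-C x y = lift-word x (word y)

      combination-lift : ∀ x y → ◇ (combination a (lift-C x y) ≈ C x y)
      combination-lift x y = combination-word x (word y) >>= λ eq →
        pure (trans eq (C-cong G.refl (proj₂ (generating y))))

      module Separated (l : Vector ℤ n) (kills : ∀ k → combination a k ≈ ε → ◇ (dot l k ≡ 0ℤ)) where

        D : G.Carrier → G.Carrier → ℤ
        D x y = dot l (lift-C x y)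

        -- Exponent vectors of the same element differ by a relation, which `l` kills. So identities
        -- between values of `C` pass to `D` although the lifts depend on chosen words.
        transfer : ∀ {k k′} → combination a k ≈ combination a k′ → ◇ (dot l k ≡ dot l k′)
        transfer {k} {k′} eq = kills (λ i → k i - k′ i)
          (trans (combination-minus a k k′) (trans (∙-congʳ eq) (inverseʳ _))) >>= λ eq′ →
          pure (ℤ.i-j≡0⇒i≡j _ _ (≡.trans (≡.sym (dot-minus l k k′)) eq′))

        D-cong : ∀ {x x′ y y′} → x G.≈ x′ → y G.≈ y′ → ◇ (D x y ≡ D x′ y′)
        D-cong {x} {x′} {y} {y′} x≈x′ y≈y′ = combination-lift x y >>= λ e₁ → combination-lift x′ y′ >>= λ e₂ →
          transfer (trans e₁ (trans (C-cong x≈x′ y≈y′) (sym e₂)))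

        D-ε : ∀ x → ◇ (D x G.ε ≡ 0ℤ)
        D-ε x = combination-lift x G.ε >>= λ eq → kills (lift-C x G.ε) (trans eq (C-ε x))

        D-cocycle : ∀ x y z → ◇ (D x y + D (x G.∙ y) z ≡ D y z + D x (y G.∙ z))
        D-cocycle x y z =
          combination-lift x y >>= λ e₁ →
          combination-lift (x G.∙ y) z >>= λ e₂ →
          combination-lift y z >>= λ e₃ →
          combination-lift x (y G.∙ z) >>= λ e₄ →
          transfer {λ i → lift-C x y i + lift-C (x G.∙ y) z i} {λ i → lift-C y z i + lift-C x (y G.∙ z) i}
            (trans (combination-+ a _ _) (trans (∙-cong e₁ e₂) (trans (cocycle x y z)
              (sym (trans (combination-+ a _ _) (∙-cong e₃ e₄)))))) >>= λ eq →
          pure (≡.trans (≡.sym (dot-+ l (lift-C x y) (lift-C (x G.∙ y) z)))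
            (≡.trans eq (dot-+ l (lift-C y z) (lift-C x (y G.∙ z)))))

        dot-jump : ∀ x i → dot l (jump x i) ≡ l (edge x i) - l (edge G.ε i)
        dot-jump x i = ≡.trans (dot-minus l (unit (edge x i)) (unit (edge G.ε i)))
          (≡.cong₂ _-_ (dot-unit l (edge x i)) (dot-unit l (edge G.ε i)))

        D-u : ∀ x i → ◇ (D x (u i) ≡ l (edge x i) - l (edge G.ε i))
        D-u x i = combination-lift x (u i) >>= λ e₁ → combination-jump x i >>= λ e₂ →
          transfer {lift-C x (u i)} {jump x i} (trans e₁ (sym e₂)) >>= λ eq → pure (≡.trans eq (dot-jump x i))

        -- Both sums of l (edge x i) and l (edge ε i) run over all of Fin n.
        D-harmonic : ∀ x → ◇ (sum (λ i → D x (u i)) ≡ 0ℤ)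
        D-harmonic x =
          ◇-Fin (D-u x) >>= λ eqs →
          edge-bijective x >>= λ (π , π-eq) →
          edge-bijective G.ε >>= λ (ρ , ρ-eq) →
          pure (≡.trans (sum-cong-≗ eqs) (≡.trans (sum-minus (λ i → l (edge x i)) (λ i → l (edge G.ε i)))
            (ℤ.i≡j⇒i-j≡0 (≡.trans (≡.sym (sum-edge π π-eq)) (sum-edge ρ ρ-eq)))))
          where
          sum-edge : ∀ (π : Permutation m n) {f : Fin m → Fin n} → (∀ i → π ⟨$⟩ʳ i ≡ f i) → sum l ≡ sum (λ i → l (f i))
          sum-edge π eq = ≡.trans (sum-permute l π) (sum-cong-≗ λ i → ≡.cong l (eq i))

        -- The word fixes how many jumps occur, and `x` only decides which entries of `l` they
        -- involve. A jump contributes at most 2L and each of the two shorter lifts at most `B`.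
        word-bounded : ∀ w → Σ ℕ λ B → ∀ x → ∣ dot l (lift-word x w) ∣ ℕ.≤ B
        word-bounded [] = 0 , λ x → ℕ.≤-reflexive (≡.cong ∣_∣ (dot-zeroʳ l))
        word-bounded (i ∷ w) with word-bounded w | uniform-bound l
        ... | B , ≤B | L , ≤L = ((L ℕ.+ L) ℕ.+ B) ℕ.+ B , λ x → begin
            ∣ dot l (lift-word x (i ∷ w)) ∣
              ≡⟨ ≡.cong ∣_∣ (≡.trans (dot-minus l (λ j → jump x i j + lift-word (x G.∙ u i) w j) (lift-word (u i) w))
                  (≡.cong (_- dot l (lift-word (u i) w)) (≡.trans (dot-+ l (jump x i) (lift-word (x G.∙ u i) w))
                    (≡.cong (_+ dot l (lift-word (x G.∙ u i) w)) (dot-jump x i))))) ⟩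
            ∣ (l (edge x i) - l (edge G.ε i)) + dot l (lift-word (x G.∙ u i) w) - dot l (lift-word (u i) w) ∣
              ≤⟨ ℤ.∣i-j∣≤∣i∣+∣j∣ (l (edge x i) - l (edge G.ε i) + dot l (lift-word (x G.∙ u i) w)) _ ⟩
            ∣ (l (edge x i) - l (edge G.ε i)) + dot l (lift-word (x G.∙ u i) w) ∣ ℕ.+ ∣ dot l (lift-word (u i) w) ∣
              ≤⟨ ℕ.+-mono-≤ (ℤ.∣i+j∣≤∣i∣+∣j∣ (l (edge x i) - l (edge G.ε i)) _) (≤B (u i)) ⟩
            (∣ l (edge x i) - l (edge G.ε i) ∣ ℕ.+ ∣ dot l (lift-word (x G.∙ u i) w) ∣) ℕ.+ B
              ≤⟨ ℕ.+-monoˡ-≤ B (ℕ.+-mono-≤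
                   (ℕ.≤-trans (ℤ.∣i-j∣≤∣i∣+∣j∣ (l (edge x i)) _) (ℕ.+-mono-≤ (≤L _) (≤L _))) (≤B (x G.∙ u i))) ⟩
            ((L ℕ.+ L) ℕ.+ B) ℕ.+ B ∎
          where open ℕ.≤-Reasoning

        D-vanishes : ∀ x y → ◇ (D x y ≡ 0ℤ)
        D-vanishes = BoundedCocycle.vanishes T G nil u generating
          D D-cong D-ε D-cocycle D-harmonic (λ y → word-bounded (word y))

  -- By `separation`, either a nonzero multiple of the lifted defect is a relation, and the defect
  -- is torsion, or some functional is nonzero on it, which contradicts `D-vanishes`. The local
  -- structure is asked for at every `T` because falsity is taken to be the goal itself, which
  -- varies with `x`, `y` and with the quotient.
  defect-torsion : (∀ {t} (T : Set t) → Classical.◇ T (LocalStructure T G Q φ)) →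
    ∀ x y → IsTorsion Q (defect G Q φ x y)
  defect-torsion localStructure x y = proof λ torsion → torsion
    where
    T = IsTorsion Q (defect G Q φ x y)
    open Classical T
    proof : ◇ T
    proof =
      localStructure T >>= λ local → Q.potentials T (LocalStructure.v local) >>= λ (a , potential) →
      separation T (λ k → combination a k ≈ ε) (relations a) (Lifting.lift-C T local a potential x y) >>= λ where
        (inj₁ (b , b≢0 , eq)) → Lifting.combination-lift T local a potential x y >>= λ eq′ → pure (Q.torsion-centre
          (Powers.torsion-cong group eq′ (zpow-torsion b b≢0 (trans (sym (combination-scale a b _)) eq))))
        (inj₂ (l , l≢0 , kills)) → Lifting.Separated.D-vanishes T local a potential l kills x y >>= λ eq →
          contradiction eq l≢0

localStructure-quotient : {T : Set t} {G : Group c₁ ℓ₁} {Q : Group c₂ ℓ₂} {φ : Group.Carrier G → Group.Carrier Q}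
  {M : Group.Carrier Q → Set r} (N : IsNormal Q M) → LocalStructure T G Q φ → LocalStructure T G (Quotient Q N) φ
localStructure-quotient {Q = Q} N local = record
  { u = u ; v = v ; generating = generating ; edge = edge
  ; edge-eq = λ x i → ≈⇒M Q N (edge-eq x i)
  ; edge-bijective = edge-bijective
  }
  where open LocalStructure local

-- Induction along the central series of the target

module _ (G : Group c₁ ℓ₁) (nil : IsNilpotent G) where
  private module G = Group G

  -- By induction the defect is torsion, hence has a central power, modulo the centre of Q;
  -- so it is central in the quotient of Q by its torsion subgroup.
  defect-torsion : ∀ k {c ℓ} (Q : Group c ℓ) → (∀ z → UpperCentral Q k z) →
    (φ : G.Carrier → Group.Carrier Q) →
    (∀ x y → x G.≈ y → Group._≈_ Q (φ x) (φ y)) → Group._≈_ Q (φ G.ε) (Group.ε Q) →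
    (∀ {t} (T : Set t) → Classical.◇ T (LocalStructure T G Q φ)) →
    ∀ x y → IsTorsion Q (defect G Q φ x y)
  defect-torsion zero Q nilQ φ φ-cong φ-ε loc x y =
    Powers.torsion-cong Q (Group.sym Q (lower (nilQ _))) (Powers.torsion-ε Q)
  defect-torsion (suc k) Q nilQ φ φ-cong φ-ε local x y = torsion-mod-torsion
    (CentralDefect.defect-torsion G nil Q/T φ
      (λ x y x≈y → ≈⇒M Q tors (φ-cong x y x≈y)) (≈⇒M Q tors φ-ε) central
      (λ T → Classical.map T (localStructure-quotient tors) (local T)) x y)
    where
    open Group Q
    open GroupSolver Q
    open Nilpotent Q
    tors = torsion-normal (suc k , nilQ)
    Z = UpperCentral-normal 1
    Q/T = Quotient Q tors
    Q/Z = Quotient Q Z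

    torsion-mod-torsion : ∀ {z} → IsTorsion Q/T z → IsTorsion Q z
    torsion-mod-torsion {z} (n , eq) = Powers.torsion-root Q n
      (≡.subst (IsTorsion Q) (pow-Quotient Q tors (suc n) z) (≈ε⇒M Q tors eq))

    torsion-mod-centre : ∀ x y → IsTorsion Q/Z (defect G Q φ x y)
    torsion-mod-centre = defect-torsion k Q/Z (λ z → UpperCentral-mod-centre k (nilQ z)) φ
      (λ x y x≈y → ≈⇒M Q Z (φ-cong x y x≈y)) (≈⇒M Q Z φ-ε)
      (λ T → Classical.map T (localStructure-quotient Z) (local T))

    central : ∀ x y → Centre.IsCentral Q/T (defect G Q φ x y)
    central x y w with torsion-mod-centre x y
    ... | n , eq = IsNormal.resp tors
      (solve 2 (λ z w → commᴱ z w ⊖¹ ⊜ (z ⊕ w) ⊖¹ ⊕ (w ⊕ z)) refl z w)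
      (IsNormal.has-⁻¹ tors (root-of-central (suc k , nilQ) n z
        (≡.subst (UpperCentral Q 1) (pow-Quotient Q Z (suc n) z) (≈ε⇒M Q Z eq)) w))
      where z = defect G Q φ x y

-- The local structure of a Cayley isomorphism, and its inverse

module _ (T : Set t) (G : Group c ℓ) where
  open Group G
  open Classical T

  -- A generating list may repeat elements, and then neighbours would not correspond bijectively to
  -- its positions. As equality is undecidable, repetitions can be removed only under `◇`.
  record Distinct (L : List Carrier) : Set (c ⊔ ℓ ⊔ t) where
    field
      {size}   : ℕ
      elem     : Fin size → Carrier
      sound    : ∀ i → _∈S_ G (elem i) L
      index    : ∀ {x} → _∈S_ G x L → Fin size
      index-eq : ∀ {x} (x∈L : _∈S_ G x L) → x ≈ elem (index x∈L)
      distinct : ∀ i j → elem i ≈ elem j → ◇ (i ≡ j)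

  deduplicate : ∀ L → ◇ (Distinct L)
  deduplicate [] = pure record
    { size = 0 ; elem = λ () ; sound = λ () ; index = λ () ; index-eq = λ () ; distinct = λ () }
  deduplicate (x ∷ L) = deduplicate L >>= λ d →
    excluded-middle (Σ (Fin (Distinct.size d)) λ i → x ≈ Distinct.elem d i) >>= λ where
      (inj₁ (i , x≈)) → pure (let open Distinct d in record
        { elem = elem
        ; sound = λ i → there (sound i)
        ; index = λ { (here _) → i ; (there y∈L) → index y∈L }
        ; index-eq = λ { (here y≈x) → trans y≈x x≈ ; (there y∈L) → index-eq y∈L }
        ; distinct = distinct
        })
      (inj₂ new) → pure (let open Distinct d in record
        { elem = x ◂ elem
        ; sound = λ { zero → here refl ; (suc i) → there (sound i) }
        ; index = λ { (here _) → zero ; (there y∈L) → suc (index y∈L) }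
        ; index-eq = λ { (here y≈x) → y≈x ; (there y∈L) → index-eq y∈L }
        ; distinct = λ where
            zero    zero    _  → pure ≡.refl
            zero    (suc j) eq → λ _ → new (j , eq)
            (suc i) zero    eq → λ _ → new (i , sym eq)
            (suc i) (suc j) eq → distinct i j eq >>= λ i≡j → pure (≡.cong suc i≡j)
        })

module _ {G₁ : Group c₁ ℓ₁} {G₂ : Group c₂ ℓ₂} where
  private
    module G₁ = Group G₁
    module G₂ = Group G₂

  module _ {S₁ : List G₁.Carrier} {S₂ : List G₂.Carrier} {φ : G₁.Carrier → G₂.Carrier}
    (iso : IsCayleyIso G₁ G₂ S₁ S₂ φ) where
    open IsCayleyIso iso

    localStructure : Generates G₁ S₁ → (T : Set t) → Classical.◇ T (LocalStructure T G₁ G₂ φ)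
    localStructure gen T = deduplicate T G₁ S₁ >>= λ d₁ → deduplicate T G₂ S₂ >>= λ d₂ → pure (structure d₁ d₂)
      where
      open Classical T
      module _ (d₁ : Distinct T G₁ S₁) (d₂ : Distinct T G₂ S₂) where
        private
          module D₁ = Distinct d₁
          module D₂ = Distinct d₂
        open Words G₁ D₁.elem

        generating : Generating
        generating g with gen g
        ... | w , w∈S , eq = proj₁ (indices w w∈S) , G₁.trans (proj₂ (indices w w∈S)) eq
          where
          indices : ∀ w → All (λ s → _∈S_ G₁ s S₁) w →
            Σ (List (Fin D₁.size)) λ is → evaluate is G₁.≈ foldr G₁._∙_ G₁.ε w
          indices []      []          = [] , G₁.refl
          indices (s ∷ w) (s∈S ∷ w∈S) = let (is , eq) = indices w w∈S in
            D₁.index s∈S ∷ is , G₁.∙-cong (G₁.sym (D₁.index-eq s∈S)) eq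

        forward : ∀ x i → Σ (Fin D₂.size) λ j → φ (x G₁.∙ D₁.elem i) G₂.≈ φ x G₂.∙ D₂.elem j
        forward x i with adj-pres x (x G₁.∙ D₁.elem i) (D₁.elem i , D₁.sound i , G₁.refl)
        ... | s , s∈S , eq = D₂.index s∈S , G₂.trans eq (G₂.∙-congˡ (D₂.index-eq s∈S))

        backward : ∀ x j → Σ (Fin D₁.size) λ i → φ (x G₁.∙ D₁.elem i) G₂.≈ φ x G₂.∙ D₂.elem j
        backward x j with surjective (φ x G₂.∙ D₂.elem j)
        ... | y , φy≈ with adj-refl x y (D₂.elem j , D₂.sound j , φy≈)
        ... | s , s∈S , y≈xs = D₁.index s∈S ,
          G₂.trans (φ-cong _ _ (G₁.sym (G₁.trans y≈xs (G₁.∙-congˡ (D₁.index-eq s∈S))))) φy≈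

        structure : LocalStructure T G₁ G₂ φ
        structure = record
          { u = D₁.elem
          ; v = D₂.elem
          ; generating = generating
          ; edge = λ x i → proj₁ (forward x i)
          ; edge-eq = λ x i → proj₂ (forward x i)
          ; edge-bijective = λ x →
              -- Each composite preserves the element reached, hence, after cancellation, the
              -- generator; `distinct` recovers its index.
              ◇-Fin (λ j → D₂.distinct (proj₁ (forward x (proj₁ (backward x j)))) j
                (GroupProperties.∙-cancelˡ G₂ (φ x) _ _
                  (G₂.trans (G₂.sym (proj₂ (forward x (proj₁ (backward x j))))) (proj₂ (backward x j))))) >>= λ invˡ →
              ◇-Fin (λ i → D₁.distinct (proj₁ (backward x (proj₁ (forward x i)))) i
                (GroupProperties.∙-cancelˡ G₁ x _ _ (injective _ _
                  (G₂.trans (proj₂ (backward x (proj₁ (forward x i)))) (G₂.sym (proj₂ (forward x i))))))) >>= λ invʳ →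
              pure (permutation (λ i → proj₁ (forward x i)) (λ j → proj₁ (backward x j)) invˡ invʳ , λ i → ≡.refl)
          }

    inverse : G₂.Carrier → G₁.Carrier
    inverse z = proj₁ (surjective z)

    φ-inverse : ∀ z → φ (inverse z) G₂.≈ z
    φ-inverse z = proj₂ (surjective z)

    inverse-φ : ∀ x → inverse (φ x) G₁.≈ x
    inverse-φ x = injective _ _ (φ-inverse (φ x))

    inverse-iso : IsCayleyIso G₂ G₁ S₂ S₁ inverse
    inverse-iso = record
      { φ-cong     = λ x y x≈y → injective _ _ (G₂.trans (φ-inverse x) (G₂.trans x≈y (G₂.sym (φ-inverse y))))
      ; injective  = λ x y eq → G₂.trans (G₂.sym (φ-inverse x)) (G₂.trans (φ-cong _ _ eq) (φ-inverse y))
      ; surjective = λ z → φ z , inverse-φ z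
      ; adj-pres   = λ x y (s , s∈S , eq) → adj-refl _ _
          (s , s∈S , G₂.trans (φ-inverse y) (G₂.trans eq (G₂.∙-congʳ (G₂.sym (φ-inverse x)))))
      ; adj-refl   = λ x y adj → let (s , s∈S , eq) = adj-pres _ _ adj in
          s , s∈S , G₂.trans (G₂.sym (φ-inverse y)) (G₂.trans eq (G₂.∙-congʳ (φ-inverse x)))
      }

    translate-iso : ∀ a → IsCayleyIso G₁ G₂ S₁ S₂ (λ x → a G₂.∙ φ x)
    translate-iso a = record
      { φ-cong     = λ x y x≈y → G₂.∙-congˡ (φ-cong x y x≈y)
      ; injective  = λ x y eq → injective x y (∙-cancelˡ a _ _ eq)
      ; surjective = λ z → inverse (a G₂.⁻¹ G₂.∙ z) , G₂.trans (G₂.∙-congˡ (φ-inverse _)) (\\-leftDividesˡ a z)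
      ; adj-pres   = λ x y adj → let (s , s∈S , eq) = adj-pres x y adj in
          s , s∈S , G₂.trans (G₂.∙-congˡ eq) (G₂.sym (G₂.assoc _ _ _))
      ; adj-refl   = λ x y (s , s∈S , eq) → adj-refl x y (s , s∈S , ∙-cancelˡ a _ _ (G₂.trans eq (G₂.assoc _ _ _)))
      }
      where open GroupProperties G₂

    module Normalised (nil₁ : IsNilpotent G₁) (nil₂ : IsNilpotent G₂) (gen : Generates G₁ S₁)
      (φ-ε : φ G₁.ε G₂.≈ G₂.ε) where
      private
        tors = Nilpotent.torsion-normal G₂ nil₂
        H = Quotient G₂ tors
        module H = Group H

      φ-∙ : ∀ x y → φ x G₂.∙ φ y H.≈ φ (x G₁.∙ y)
      φ-∙ = defect-torsion G₁ nil₁ (proj₁ nil₂) G₂ (proj₂ nil₂) φ φ-cong φ-ε (localStructure gen)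

      φ-pow : ∀ n x → pow G₂ n (φ x) H.≈ φ (pow G₁ n x)
      φ-pow zero    x = H.sym (≈⇒M G₂ tors φ-ε)
      φ-pow (suc n) x = H.trans (H.∙-congˡ {φ x} (φ-pow n x)) (φ-∙ x (pow G₁ n x))

      -- Modulo torsion `φ` respects powers, so a power of `φ x` is congruent to φ(1) = 1; a root of
      -- a torsion element is torsion.
      φ-torsion : ∀ {x} → IsTorsion G₁ x → φ x H.≈ G₂.ε
      φ-torsion {x} (n , eq) = M⇒≈ε G₂ tors (Powers.torsion-root G₂ n (≈ε⇒M G₂ tors
        (H.trans (φ-pow (suc n) x) (≈⇒M G₂ tors (G₂.trans (φ-cong _ _ eq) φ-ε)))))

      well-defined : InducedWellDefined G₁ G₂ φ
      well-defined x y x∼y = H.sym (begin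
        φ y                         ≈⟨ ≈⇒M G₂ tors (φ-cong _ _ (\\-leftDividesˡ x y)) ⟨
        φ (x G₁.∙ (x G₁.⁻¹ G₁.∙ y)) ≈⟨ φ-∙ x _ ⟨
        φ x G₂.∙ φ (x G₁.⁻¹ G₁.∙ y) ≈⟨ H.∙-congˡ {φ x} (φ-torsion x∼y) ⟩
        φ x G₂.∙ G₂.ε               ≈⟨ H.identityʳ (φ x) ⟩
        φ x                         ∎)
        where
        open SetoidReasoning H.setoid
        open GroupProperties G₁

-- The induced affine bijection

theorem1p11 : {c₁ ℓ₁ c₂ ℓ₂ : Level} (G₁ : Group c₁ ℓ₁) (G₂ : Group c₂ ℓ₂)
    → IsNilpotent G₁ → IsNilpotent G₂
    → (S₁ : List (Group.Carrier G₁)) (S₂ : List (Group.Carrier G₂))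
    → IsSymFinGenSet G₁ S₁ → IsSymFinGenSet G₂ S₂
    → (φ : Group.Carrier G₁ → Group.Carrier G₂)
    → IsCayleyIso G₁ G₂ S₁ S₂ φ
    → InducedWellDefined G₁ G₂ φ × InducedIsAffineBijection G₁ G₂ φ
theorem1p11 G₁ G₂ nil₁ nil₂ S₁ S₂ (_ , gen₁) (_ , gen₂) φ iso =
    -- `α` differs from `φ` by a left translation, which cancels in φ(x)⁻¹φ(y).
    (λ x y x∼y → torsion-cong (quotient-α x y) (A.well-defined x y x∼y))
  , α
  , ( A.well-defined
    , (λ x y → Group.sym H (A.φ-∙ x y))
    -- Injectivity on cosets is well-definedness of the map induced by the inverse isomorphism.
    , (λ x y αx∼αy → Powers.torsion-cong G₁
        (G₁.∙-cong (G₁.⁻¹-cong (inverse-φ α-iso x)) (inverse-φ α-iso y))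
        (B.well-defined (α x) (α y) αx∼αy))
    , (λ z → inverse α-iso z , ≈⇒M G₂ tors (φ-inverse α-iso z)) )
  , φ G₁.ε
  , (λ x → ≈⇒M G₂ tors (G₂.sym (\\-leftDividesˡ (φ G₁.ε) (φ x))))
  where
  module G₁ = Group G₁
  module G₂ = Group G₂
  open Powers G₂ using (torsion-cong)
  open GroupProperties G₂ using (\\-leftDividesˡ)
  open GroupSolver G₂
  tors = Nilpotent.torsion-normal G₂ nil₂
  H = Quotient G₂ tors
  α : G₁.Carrier → G₂.Carrier
  α x = φ G₁.ε G₂.⁻¹ G₂.∙ φ x
  α-iso : IsCayleyIso G₁ G₂ S₁ S₂ α
  α-iso = translate-iso iso (φ G₁.ε G₂.⁻¹)
  α-ε : α G₁.ε G₂.≈ G₂.ε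
  α-ε = G₂.inverseˡ (φ G₁.ε)
  module A = Normalised α-iso nil₁ nil₂ gen₁ α-ε
  module B = Normalised (inverse-iso α-iso) nil₂ nil₁ gen₂
    (G₁.trans (IsCayleyIso.φ-cong (inverse-iso α-iso) _ _ (G₂.sym α-ε)) (inverse-φ α-iso G₁.ε))
  quotient-α : ∀ x y → α x G₂.⁻¹ G₂.∙ α y G₂.≈ φ x G₂.⁻¹ G₂.∙ φ y
  quotient-α x y = solve 3 (λ a p q → (a ⊖¹ ⊕ p) ⊖¹ ⊕ (a ⊖¹ ⊕ q) ⊜ p ⊖¹ ⊕ q) G₂.refl (φ G₁.ε) (φ x) (φ y)
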